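{- For every integer $k\ge2$, the formal power series $$H_k(x,q):=\sum_{n\ge1}x^n\sum_{w\in\mathcal F_{n,k}}q^{\mathrm{Ham}(G(w))}$$ is equal to $$\frac{x\left((1-x)x\bigl(1-x^{2\lfloor (k-1)/2\rfloor}\bigr)-q(1+x)(1-2x+x^{k+1})\bigl(-2+x+x^{2\lfloor k/2\rfloor}\bigr)\right)}{(1-2x+x^{k+1})\left(1-x-2x^2+x^3+x^{2(1+\lfloor k/2\rfloor)}\right)}.$$
   Context: For integers $k\ge 2$, $n\ge1$, $\mathcal F_{n,k}$ is the set of binary words $w=w_1\cdots w_n$ with no $k$ consecutive $1$'s. $P(w)$ is the bargraph polyomino formed by the unit squares $[i-1,i]\times[j-1,j]$, $1\le i\le n$, $1\le j\le w_i+1$. $G(w)$ is the graph whose vertices are the corners of the cells of $P(w)$ and whose edges are the cell sides. $\mathrm{Ham}(G)=1$ if $G$ has a Hamiltonian cycle (a cycle visiting every vertex exactly once) and $\mathrm{Ham}(G)=0$ otherwise. -}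

module Defs where

open import Data.Bool using (Bool; true; false; _≟_)
open import Data.Nat as ℕ using (ℕ; zero; suc; _<_; _≤_)
open import Data.Integer as ℤ using (ℤ; +_)
open import Data.List using (List; []; _∷_; _++_; [_]; length; replicate; filter; concatMap)
open import Data.List.Relation.Binary.Infix.Heterogeneous using (Infix)
open import Data.List.Relation.Binary.Infix.Heterogeneous.Properties using (infix?)
open import Data.List.Relation.Unary.Linked using (Linked)
open import Data.List.Relation.Unary.All using (All)
open import Data.List.Relation.Unary.Unique.Propositional using (Unique)
open import Data.List.Membership.Propositional using (_∈_)
open import Data.Product using (Σ; ∃; ∃-syntax; _×_; _,_)
open import Data.Sum using (_⊎_)
open import Relation.Nullary using (¬_; ¬?)
open import Relation.Nullary.Decidable using (⌊_⌋)
open import Relation.Binary.PropositionalEquality using (_≡_)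

-- Binary words (lists of Booleans, true = 1) and the family F_{n,k}

allWords : ℕ → List (List Bool)
allWords zero    = [] ∷ []
allWords (suc n) = concatMap (λ w → (false ∷ w) ∷ (true ∷ w) ∷ []) (allWords n)

HasRun : ℕ → List Bool → Set
HasRun k w = Infix _≡_ (replicate k true) w

F : ℕ → ℕ → List (List Bool)
F n k = filter (λ w → ¬? (infix? _≟_ (replicate k true) w)) (allWords n)

-- The bargraph P(w) and its graph G(w)
-- (coordinates shifted by one: column i ∈ {0..n-1}, row j; the cell (i,j)
--  is the unit square [i,i+1] × [j,j+1]; column i has height w_{i+1}+1)

heightAt : List Bool → ℕ → ℕ
heightAt []          _       = 0
heightAt (false ∷ w) zero    = 1
heightAt (true  ∷ w) zero    = 2
heightAt (b ∷ w)     (suc i) = heightAt w i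

Cell : List Bool → ℕ → ℕ → Set
Cell w i j = j < heightAt w i

Point : Set
Point = ℕ × ℕ

IsVertex : List Bool → Point → Set
IsVertex w (a , b) = ∃[ i ] ∃[ j ] (Cell w i j × (a ≡ i ⊎ a ≡ suc i) × (b ≡ j ⊎ b ≡ suc j))

data Side (i j : ℕ) : Point → Point → Set where
  bottom : Side i j (i , j)     (suc i , j)
  top    : Side i j (i , suc j) (suc i , suc j)
  left   : Side i j (i , j)     (i , suc j)
  right  : Side i j (suc i , j) (suc i , suc j)

Edge : List Bool → Point → Point → Set
Edge w u v = ∃[ i ] ∃[ j ] (Cell w i j × (Side i j u v ⊎ Side i j v u))

IsHamCycle : List Bool → Point → List Point → Set
IsHamCycle w v vs =
  (3 ≤ length (v ∷ vs)) ×
  Unique (v ∷ vs) ×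
  All (IsVertex w) (v ∷ vs) ×
  (∀ p → IsVertex w p → p ∈ (v ∷ vs)) ×
  Linked (Edge w) (v ∷ vs ++ [ v ])

HasHamCycle : List Bool → Set
HasHamCycle w = ∃[ v ] ∃[ vs ] IsHamCycle w v vs

IsHamIndicator : (List Bool → ℕ) → Set
IsHamIndicator ham =
  ∀ w → (HasHamCycle w × ham w ≡ 1) ⊎ (¬ HasHamCycle w × ham w ≡ 0)

-- Formal power series in x and q with integer coefficients:
-- s n m is the coefficient of x^n q^m.

Series : Set
Series = ℕ → ℕ → ℤ

sumTo : ℕ → (ℕ → ℤ) → ℤ
sumTo zero    f = f zero
sumTo (suc n) f = sumTo n f ℤ.+ f (suc n)

infixl 6 _⊕_ _⊖_
infixl 7 _⊗_
infixr 8 _^^_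

_⊕_ : Series → Series → Series
(f ⊕ g) n m = f n m ℤ.+ g n m

⊝_ : Series → Series
(⊝ f) n m = ℤ.- f n m

_⊖_ : Series → Series → Series
f ⊖ g = f ⊕ (⊝ g)

_⊗_ : Series → Series → Series
(f ⊗ g) n m = sumTo n λ i → sumTo m λ j → f i j ℤ.* g (n ℕ.∸ i) (m ℕ.∸ j)

C : ℤ → Series
C c zero zero = c
C c _    _    = + 0

X : Series
X (suc zero) zero = + 1
X _          _    = + 0

Q : Series
Q zero (suc zero) = + 1
Q _    _          = + 0

_^^_ : Series → ℕ → Series
f ^^ zero  = C (+ 1)
f ^^ suc e = f ⊗ (f ^^ e)

H : ℕ → (List Bool → ℕ) → Series
H k ham zero    m = + 0
H k ham (suc n) m = + length (filter (λ w → ham w ℕ.≟ m) (F (suc n) k))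

Num : ℕ → Series
Num k = X ⊗ ( (C (+ 1) ⊖ X) ⊗ X ⊗ (C (+ 1) ⊖ X ^^ (2 ℕ.* ((k ℕ.∸ 1) ℕ./ 2)))
            ⊖ Q ⊗ (C (+ 1) ⊕ X) ⊗ (C (+ 1) ⊖ C (+ 2) ⊗ X ⊕ X ^^ (k ℕ.+ 1))
                ⊗ (C (ℤ.- (+ 2)) ⊕ X ⊕ X ^^ (2 ℕ.* (k ℕ./ 2))) )

Den : ℕ → Series
Den k = (C (+ 1) ⊖ C (+ 2) ⊗ X ⊕ X ^^ (k ℕ.+ 1))
      ⊗ (C (+ 1) ⊖ X ⊖ C (+ 2) ⊗ X ^^ 2 ⊕ X ^^ 3 ⊕ X ^^ (2 ℕ.* (1 ℕ.+ k ℕ./ 2)))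

{-# OPTIONS --safe #-}

-- G(w) is Hamiltonian iff every maximal run of 1s in w has odd length.  If all
-- runs are odd, the bottom row closes up with a path along the upper rows that
-- makes a tooth over every other column of each run.  If some run has length
-- 2s > 0, delete the smaller colour class of the 3 × (2s+1) grid below it: this
-- removes 3s+1 vertices and leaves 3s+2 components (all that lies to the left
-- or right of the run hangs on a single bottom corner), which no cycle allows.
--
-- Let T and A be the generating series, empty word included, of all words
-- without k consecutive 1s and of those with odd runs only.  Reading the words
-- letter by letter gives (1 - x) T = (1 + x T)(1 - x^k) and, with O the series
-- of the continuations of an initial 1, A = 1 + x A + x O and
-- (1 - x²) O = (1 + x A)(1 - x^(2⌊k/2⌋)); finally H = (T - 1) + (q - 1)(A - 1).

module Submission where

open import Defs
open import Algebra.Bundles using (CommutativeRing)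
import Algebra.Properties.CommutativeSemigroup as CommutativeSemigroupProperties
import Algebra.Solver.Ring as RingSolver
open import Algebra.Solver.Ring.AlmostCommutativeRing using (_-Raw-AlmostCommutative⟶_; fromCommutativeRing)
open import Data.Bool using (Bool; true; false; not; _∧_; if_then_else_)
open import Data.Bool.Properties as Bool using (not-involutive; not-¬; ∧-zeroʳ)
open import Data.Empty using (⊥-elim)
open import Data.Integer as ℤ using (ℤ; +_)
import Data.Integer.Properties as ℤ
open import Data.List using (List; []; _∷_; _++_; [_]; length; filter; replicate; concatMap)
open import Data.List.Membership.Propositional using (_∈_)
open import Data.List.Membership.Propositional.Properties using (∈-filter⁻; ∈-∃++; ∈-++⁺ˡ; ∈-++⁺ʳ; ∈-++⁻)
open import Data.List.Properties using (length-++; filter-++)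
open import Data.List.Relation.Binary.Infix.Heterogeneous using (here; there)
open import Data.List.Relation.Binary.Infix.Heterogeneous.Properties using (infix?)
open import Data.List.Relation.Binary.Prefix.Heterogeneous using (Prefix; []; _∷_)
open import Data.List.Relation.Unary.All as All using (All; []; _∷_)
open import Data.List.Relation.Unary.AllPairs using ([]; _∷_)
open import Data.List.Relation.Unary.Any using (here; there)
open import Data.List.Relation.Unary.Linked using (Linked; [-]; _∷_)
open import Data.List.Relation.Unary.Unique.Propositional using (Unique)
open import Data.List.Relation.Unary.Unique.Propositional.Properties using (filter⁺)
open import Data.Maybe using (Maybe; just; nothing)
open import Data.Nat as ℕ using (ℕ; zero; suc; _≤_; _<_; z≤n; s≤s)
open import Data.Nat.DivMod using (m/n≡1+[m∸n]/n)
import Data.Nat.Properties as ℕ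
open import Data.Product using (_×_; _,_; proj₁; proj₂; ∃-syntax)
open import Data.Sum using (_⊎_; inj₁; inj₂)
open import Function using (_∘_)
open import Level using (0ℓ)
open import Relation.Binary.PropositionalEquality as ≡ using (_≡_; _≢_; refl; sym; trans; cong; cong₂; subst)
open import Relation.Nullary using (¬_; ¬?; Dec; yes; no; does)
open import Relation.Nullary.Decidable using (dec-true; dec-false)
open import Relation.Unary using (Pred; Decidable)

-- Power series rings

module PowerSeries {c ℓ} (R : CommutativeRing c ℓ) where
  open CommutativeRing R renaming (refl to ≈-refl; sym to ≈-sym; trans to ≈-trans)
  open CommutativeSemigroupProperties +-commutativeSemigroup using (interchange)
  open import Relation.Binary.Reasoning.Setoid setoid

  private
    variable
      f f′ g g′ : ℕ → Carrier

  -- The Cauchy product by recursion on the degree, without truncated subtraction, so that the ring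
  -- laws follow by induction.
  conv : (ℕ → Carrier) → (ℕ → Carrier) → ℕ → Carrier
  conv f g zero    = f 0 * g 0
  conv f g (suc n) = f 0 * g (suc n) + conv (λ i → f (suc i)) g n

  one : ℕ → Carrier
  one zero    = 1#
  one (suc _) = 0#

  conv-cong : (∀ n → f n ≈ f′ n) → (∀ n → g n ≈ g′ n) → ∀ n → conv f g n ≈ conv f′ g′ n
  conv-cong p q zero    = *-cong (p 0) (q 0)
  conv-cong p q (suc n) = +-cong (*-cong (p 0) (q (suc n))) (conv-cong (λ i → p (suc i)) q n)

  conv-distribʳ : ∀ h f g n → conv (λ i → f i + g i) h n ≈ conv f h n + conv g h n
  conv-distribʳ h f g zero    = distribʳ _ _ _
  conv-distribʳ h f g (suc n) =
    ≈-trans (+-cong (distribʳ _ _ _) (conv-distribʳ h _ _ n)) (interchange _ _ _ _)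

  conv-*ˡ : ∀ a f g n → conv (λ i → a * f i) g n ≈ a * conv f g n
  conv-*ˡ a f g zero    = *-assoc _ _ _
  conv-*ˡ a f g (suc n) =
    ≈-trans (+-cong (*-assoc _ _ _) (conv-*ˡ a _ g n)) (≈-sym (distribˡ _ _ _))

  conv-zeroˡ : ∀ g n → conv (λ _ → 0#) g n ≈ 0#
  conv-zeroˡ g zero    = zeroˡ _
  conv-zeroˡ g (suc n) = ≈-trans (+-cong (zeroˡ _) (conv-zeroˡ g n)) (+-identityˡ _)

  conv-identityˡ : ∀ g n → conv one g n ≈ g n
  conv-identityˡ g zero    = *-identityˡ _
  conv-identityˡ g (suc n) = ≈-trans (+-cong (*-identityˡ _) (conv-zeroˡ g n)) (+-identityʳ _)

  -- The definition splits off the first term; splitting off the last one as well makes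
  -- commutativity an induction.
  conv-last : ∀ f g n → conv f g (suc n) ≈ conv f (λ i → g (suc i)) n + f (suc n) * g 0
  conv-last f g zero    = ≈-refl
  conv-last f g (suc n) = ≈-trans (+-congˡ (conv-last _ g n)) (≈-sym (+-assoc _ _ _))

  conv-comm : ∀ f g n → conv f g n ≈ conv g f n
  conv-comm f g zero    = *-comm _ _
  conv-comm f g (suc n) = begin
    f 0 * g (suc n) + conv (λ i → f (suc i)) g n   ≈⟨ +-cong (*-comm _ _) (conv-comm _ g n) ⟩
    g (suc n) * f 0 + conv g (λ i → f (suc i)) n   ≈⟨ +-comm _ _ ⟩
    conv g (λ i → f (suc i)) n + g (suc n) * f 0   ≈⟨ conv-last g f n ⟨
    conv g f (suc n)                               ∎

  conv-assoc : ∀ f g h n → conv (conv f g) h n ≈ conv f (conv g h) n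
  conv-assoc f g h zero    = *-assoc _ _ _
  conv-assoc f g h (suc n) = begin
    f 0 * g 0 * h (suc n) + conv (λ i → f 0 * g (suc i) + conv f⁺ g i) h n
      ≈⟨ +-cong (*-assoc _ _ _) (conv-distribʳ h _ _ n) ⟩
    f 0 * (g 0 * h (suc n)) + (conv (λ i → f 0 * g (suc i)) h n + conv (conv f⁺ g) h n)
      ≈⟨ +-assoc _ _ _ ⟨
    f 0 * (g 0 * h (suc n)) + conv (λ i → f 0 * g (suc i)) h n + conv (conv f⁺ g) h n
      ≈⟨ +-cong (+-congˡ (conv-*ˡ (f 0) _ h n)) (conv-assoc f⁺ g h n) ⟩
    f 0 * (g 0 * h (suc n)) + f 0 * conv (λ i → g (suc i)) h n + conv f⁺ (conv g h) n
      ≈⟨ +-congʳ (distribˡ _ _ _) ⟨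
    f 0 * (g 0 * h (suc n) + conv (λ i → g (suc i)) h n) + conv f⁺ (conv g h) n ∎
    where
      f⁺ : ℕ → Carrier
      f⁺ i = f (suc i)

  powerSeries : CommutativeRing c ℓ
  powerSeries = record
    { Carrier           = ℕ → Carrier
    ; _≈_               = λ f g → ∀ n → f n ≈ g n
    ; _+_               = λ f g n → f n + g n
    ; _*_               = conv
    ; -_                = λ f n → - f n
    ; 0#                = λ _ → 0#
    ; 1#                = one
    ; isCommutativeRing = record
      { isRing = record
        { +-isAbelianGroup = record
          { isGroup = record
            { isMonoid = record
              { isSemigroup = record
                { isMagma = record
                  { isEquivalence = record
                    { refl  = λ _ → ≈-refl
                    ; sym   = λ p n → ≈-sym (p n)
                    ; trans = λ p q n → ≈-trans (p n) (q n)
                    }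
                  ; ∙-cong = λ p q n → +-cong (p n) (q n)
                  }
                ; assoc = λ _ _ _ _ → +-assoc _ _ _
                }
              ; identity = (λ _ _ → +-identityˡ _) , (λ _ _ → +-identityʳ _)
              }
            ; inverse = (λ _ _ → -‿inverseˡ _) , (λ _ _ → -‿inverseʳ _)
            ; ⁻¹-cong = λ p n → -‿cong (p n)
            }
          ; comm = λ _ _ _ → +-comm _ _
          }
        ; *-cong     = conv-cong
        ; *-assoc    = conv-assoc
        ; *-identity = conv-identityˡ , (λ g n → ≈-trans (conv-comm g one n) (conv-identityˡ g n))
        ; distrib    = (λ f g h n → ≈-trans (conv-comm f _ n)
                          (≈-trans (conv-distribʳ f g h n) (+-cong (conv-comm g f n) (conv-comm h f n))))
                     , conv-distribʳ
        }
      ; *-comm = conv-comm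
      }
    }

-- The ring of series in x and q

private
  module Z[q]    = PowerSeries ℤ.+-*-commutativeRing
  module Z[q][x] = PowerSeries Z[q].powerSeries
  module ℤ+      = CommutativeSemigroupProperties ℤ.+-commutativeSemigroup
  module ZZ      = CommutativeRing Z[q][x].powerSeries

infix 4 _≋_
_≋_ : Series → Series → Set
f ≋ g = ∀ n m → f n m ≡ g n m

sumTo-head : ∀ n (h : ℕ → ℤ) → sumTo (suc n) h ≡ h 0 ℤ.+ sumTo n (λ i → h (suc i))
sumTo-head zero    h = refl
sumTo-head (suc n) h =
  trans (cong (ℤ._+ h (suc (suc n))) (sumTo-head n h)) (ℤ.+-assoc (h 0) _ _)

sumTo≡conv : ∀ f g m → sumTo m (λ j → f j ℤ.* g (m ℕ.∸ j)) ≡ Z[q].conv f g m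
sumTo≡conv f g zero    = refl
sumTo≡conv f g (suc m) =
  trans (sumTo-head m _) (cong (λ t → f 0 ℤ.* g (suc m) ℤ.+ t) (sumTo≡conv (λ i → f (suc i)) g m))

-- The inner sum is a convolution in q and the outer one a convolution in x over ℤ[[q]], so the
-- product is that of `powerSeries` applied twice to ℤ.
⊗≋conv : ∀ f g → f ⊗ g ≋ Z[q][x].conv f g
⊗≋conv f g zero    m = sumTo≡conv (f 0) (g 0) m
⊗≋conv f g (suc n) m =
  trans (sumTo-head n _)
          (cong₂ ℤ._+_ (sumTo≡conv (f 0) (g (suc n)) m) (⊗≋conv (λ i → f (suc i)) g n m))

C-one : C (+ 1) ≋ Z[q][x].one
C-one zero    zero    = refl
C-one zero    (suc m) = refl
C-one (suc n) m       = refl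

-- Addition is that of the iterated power series; the laws of the product are transported along
-- `⊗≋conv`.
seriesRing : CommutativeRing _ _
seriesRing = record
  { Carrier           = Series
  ; _≈_               = _≋_
  ; _+_               = _⊕_
  ; _*_               = _⊗_
  ; -_                = ⊝_
  ; 0#                = ZZ.0#
  ; 1#                = C (+ 1)
  ; isCommutativeRing = record
    { isRing = record
      { +-isAbelianGroup = ZZ.+-isAbelianGroup
      ; *-cong     = λ {f} {f′} {g} {g′} p q → via f g f′ g′ (ZZ.*-cong p q)
      ; *-assoc    = λ f g h →
          ZZ.trans (⊗≋conv (f ⊗ g) h) (ZZ.trans (ZZ.*-congʳ (⊗≋conv f g))
          (ZZ.trans (ZZ.*-assoc f g h)
          (ZZ.sym (ZZ.trans (⊗≋conv f (g ⊗ h)) (ZZ.*-congˡ (⊗≋conv g h))))))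
      ; *-identity = identityˡ , (λ f → ZZ.trans (comm f (C (+ 1))) (identityˡ f))
      ; distrib    = (λ f g h → ZZ.trans (⊗≋conv f (g ⊕ h)) (ZZ.trans (ZZ.distribˡ f g h)
                        (ZZ.sym (ZZ.+-cong (⊗≋conv f g) (⊗≋conv f h)))))
                   , (λ f g h → ZZ.trans (⊗≋conv (g ⊕ h) f) (ZZ.trans (ZZ.distribʳ f g h)
                        (ZZ.sym (ZZ.+-cong (⊗≋conv g f) (⊗≋conv h f)))))
      }
    ; *-comm = comm
    }
  }
  where
    via : ∀ f g f′ g′ → Z[q][x].conv f g ≋ Z[q][x].conv f′ g′ → f ⊗ g ≋ f′ ⊗ g′
    via f g f′ g′ p = ZZ.trans (⊗≋conv f g) (ZZ.trans p (ZZ.sym (⊗≋conv f′ g′)))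

    comm : ∀ f g → f ⊗ g ≋ g ⊗ f
    comm f g = via f g g f (ZZ.*-comm f g)

    identityˡ : ∀ f → C (+ 1) ⊗ f ≋ f
    identityˡ f = ZZ.trans (⊗≋conv (C (+ 1)) f) (ZZ.trans (ZZ.*-congʳ C-one) (ZZ.*-identityˡ f))

module 𝕊 = CommutativeRing seriesRing

X⊗-zero : ∀ f m → (X ⊗ f) 0 m ≡ + 0
X⊗-zero f m = trans (⊗≋conv X f 0 m) (ZqC.zeroˡ (f 0) m)
  where module ZqC = CommutativeRing Z[q].powerSeries

X⊗-suc : ∀ f n m → (X ⊗ f) (suc n) m ≡ f n m
X⊗-suc f n m = trans (⊗≋conv X f (suc n) m)
  (trans (cong₂ ℤ._+_ (Z[q].conv-zeroˡ (f (suc n)) m)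
              (trans (ZZ.*-congʳ {f} X⁺≋1 n m) (ZZ.*-identityˡ f n m)))
           (ℤ.+-identityˡ _))
  where
    X⁺≋1 : (λ i → X (suc i)) ≋ Z[q][x].one
    X⁺≋1 zero    zero    = refl
    X⁺≋1 zero    (suc m) = refl
    X⁺≋1 (suc n) m       = refl

-- `Q` lives in x-degree 0, so a single term of the convolution in x survives.
Q⊗-coeff : ∀ f n m → (Q ⊗ f) n m ≡ Z[q].conv (Q 0) (f n) m
Q⊗-coeff f zero    m = ⊗≋conv Q f 0 m
Q⊗-coeff f (suc n) m = trans (⊗≋conv Q f (suc n) m)
  (trans (cong (λ t → Z[q].conv (Q 0) (f (suc n)) m ℤ.+ t) (Z[q][x].conv-zeroˡ f n m)) (ℤ.+-identityʳ _))

Q⊗-zero : ∀ f n → (Q ⊗ f) n 0 ≡ + 0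
Q⊗-zero f n = Q⊗-coeff f n 0

Q⊗-suc : ∀ f n m → (Q ⊗ f) n (suc m) ≡ f n m
Q⊗-suc f n m = trans (Q⊗-coeff f n (suc m)) (trans (ℤ.+-identityˡ _)
  (trans (Z[q].conv-cong {g = f n} Q⁺≡1 (λ _ → refl) m) (Z[q].conv-identityˡ (f n) m)))
  where
    Q⁺≡1 : ∀ i → Q 0 (suc i) ≡ Z[q].one i
    Q⁺≡1 zero    = refl
    Q⁺≡1 (suc i) = refl

-- Lets the ring solver compute with integer constants as coefficients.
C-homomorphism : CommutativeRing.rawRing ℤ.+-*-commutativeRing
                   -Raw-AlmostCommutative⟶ fromCommutativeRing seriesRing
C-homomorphism = record
  { ⟦_⟧    = C
  ; +-homo = λ { a b zero zero → refl ; a b zero (suc m) → refl ; a b (suc n) m → refl }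
  ; *-homo = *-homo
  ; -‿homo = λ { a zero zero → refl ; a zero (suc m) → refl ; a (suc n) m → refl }
  ; 0-homo = λ { zero zero → refl ; zero (suc m) → refl ; (suc n) m → refl }
  ; 1-homo = λ _ _ → refl
  }
  where
    *-homo : ∀ a b → C (a ℤ.* b) ≋ C a ⊗ C b
    *-homo a b zero zero          = refl
    *-homo a b zero (suc m)       = sym (trans (⊗≋conv (C a) (C b) 0 (suc m))
      (cong₂ ℤ._+_ (ℤ.*-zeroʳ a) (Z[q].conv-zeroˡ (C b 0) m)))
    *-homo a b (suc n) m          = sym (trans (⊗≋conv (C a) (C b) (suc n) m)
      (cong₂ ℤ._+_ (trans (Z[q].conv-comm (C a 0) (λ _ → + 0) m) (Z[q].conv-zeroˡ (C a 0) m))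
                   (Z[q][x].conv-zeroˡ (C b) n m)))

-- Algebraic identities between the generating series

module Identities {c ℓ} (R : CommutativeRing c ℓ)
  (φ : CommutativeRing.rawRing ℤ.+-*-commutativeRing -Raw-AlmostCommutative⟶ fromCommutativeRing R)
  where

  open CommutativeRing R renaming (refl to ≈-refl; sym to ≈-sym; trans to ≈-trans)
  open _-Raw-AlmostCommutative⟶_ φ using () renaming (⟦_⟧ to κ)
  open import Relation.Binary.Reasoning.Setoid setoid

  private
    coeff≟ : ∀ a b → Maybe (κ a ≈ κ b)
    coeff≟ a b with a ℤ.≟ b
    ... | yes refl = just ≈-refl
    ... | no _     = nothing

    open RingSolver (CommutativeRing.rawRing ℤ.+-*-commutativeRing) (fromCommutativeRing R) φ coeff≟

    c1 c2 c-2 : ∀ {n} → Polynomial n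
    c1  = con (+ 1)
    c2  = con (+ 2)
    c-2 = con (ℤ.- (+ 2))

    I II : Carrier
    I  = κ (+ 1)
    II = κ (+ 2)

    D₁ᴾ D₂ᴾ : ∀ {n} → Polynomial n → Polynomial n → Polynomial n
    D₁ᴾ X p = c1 :- c2 :* X :+ p
    D₂ᴾ X p = c1 :- X :- c2 :* (X :* (X :* c1)) :+ X :* (X :* (X :* c1)) :+ p

  -- The factors of `Den k`, with the powers that depend on k abstracted to p. The trailing `I`
  -- copies the unfolding of `X ^^ 2` and `X ^^ 3`, so that they match `Den k` by computation.
  D₁ D₂ : Carrier → Carrier → Carrier
  D₁ X p = I - II * X + p
  D₂ X p = I - X - II * (X * (X * I)) + X * (X * (X * I)) + p

  -- With `geometric-step`, the sum of a finite geometric progression starting with F, denominator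
  -- cleared. The ratio will be `X` for arbitrary runs and `X ⊗ X` for odd ones.
  geometric-base : ∀ X F G → G ≈ F → (I - X) * G ≈ F * (I - X * I)
  geometric-base X F G e = ≈-trans (*-congˡ e)
    (solve 2 (λ X F → (c1 :- X) :* F := F :* (c1 :- X :* c1)) ≈-refl X F)

  geometric-step : ∀ X F G p → (I - X) * G ≈ F * (I - p) →
                   (I - X) * (F + X * G) ≈ F * (I - X * p)
  geometric-step X F G p e = begin
    (I - X) * (F + X * G)            ≈⟨ solve 3 (λ X F G → (c1 :- X) :* (F :+ X :* G) :=
                                          (c1 :- X) :* F :+ X :* ((c1 :- X) :* G)) ≈-refl X F G ⟩
    (I - X) * F + X * ((I - X) * G)  ≈⟨ +-congˡ (*-congˡ e) ⟩
    (I - X) * F + X * (F * (I - p))  ≈⟨ solve 3 (λ X F p → (c1 :- X) :* F :+ X :* (F :* (c1 :- p)) :=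
                                          F :* (c1 :- X :* p)) ≈-refl X F p ⟩
    F * (I - X * p)                  ∎

  -- Collecting the terms in T gives the coefficient (1 - X) - X (1 - p) = 1 - 2X + X p.
  avoiding : ∀ X T p → (I - X) * T ≈ (I + X * T) * (I - p) → D₁ X (X * p) * T ≈ I - p
  avoiding X T p e = begin
    D₁ X (X * p) * T
      ≈⟨ solve 3 (λ X T p → D₁ᴾ X (X :* p) :* T := (c1 :- X) :* T :- X :* T :+ X :* p :* T) ≈-refl X T p ⟩
    (I - X) * T - X * T + X * p * T
      ≈⟨ +-congʳ (+-congʳ e) ⟩
    (I + X * T) * (I - p) - X * T + X * p * T
      ≈⟨ solve 3 (λ X T p → (c1 :+ X :* T) :* (c1 :- p) :- X :* T :+ X :* p :* T := c1 :- p) ≈-refl X T p ⟩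
    I - p ∎

  -- Multiplying the equation for A by 1 - X² lets O be eliminated; the coefficient of A becomes (1
  -- - X)(1 - X²) - X² (1 - y), which is `D₂`.
  odd-runs : ∀ X A O y → A ≈ I + X * A + X * O → (I - X * X) * O ≈ (I + X * A) * (I - y) →
             D₂ X (X * (X * y)) * A ≈ I - X * X + X * (I - y)
  odd-runs X A O y eA eO = begin
    D₂ X (X * (X * y)) * A
      ≈⟨ solve 3 (λ X A y → D₂ᴾ X (X :* (X :* y)) :* A :=
           (c1 :- X :* X) :* A :- (c1 :- X :* X) :* (X :* A) :- X :* X :* A :* (c1 :- y)) ≈-refl X A y ⟩
    (I - X * X) * A - (I - X * X) * (X * A) - X * X * A * (I - y)
      ≈⟨ +-congʳ (+-congʳ (*-congˡ eA)) ⟩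
    (I - X * X) * (I + X * A + X * O) - (I - X * X) * (X * A) - X * X * A * (I - y)
      ≈⟨ solve 4 (λ X A O y →
           (c1 :- X :* X) :* (c1 :+ X :* A :+ X :* O) :- (c1 :- X :* X) :* (X :* A) :- X :* X :* A :* (c1 :- y) :=
           c1 :- X :* X :+ X :* ((c1 :- X :* X) :* O) :- X :* X :* A :* (c1 :- y)) ≈-refl X A O y ⟩
    I - X * X + X * ((I - X * X) * O) - X * X * A * (I - y)
      ≈⟨ +-congʳ (+-congˡ (*-congˡ eO)) ⟩
    I - X * X + X * ((I + X * A) * (I - y)) - X * X * A * (I - y)
      ≈⟨ solve 3 (λ X A y →
           c1 :- X :* X :+ X :* ((c1 :+ X :* A) :* (c1 :- y)) :- X :* X :* A :* (c1 :- y) :=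
           c1 :- X :* X :+ X :* (c1 :- y)) ≈-refl X A y ⟩
    I - X * X + X * (I - y) ∎

  -- Clears both denominators, so that a polynomial identity is all that remains to be checked.
  combine : ∀ d₁ d₂ Q T A t a → d₁ * T ≈ t → d₂ * A ≈ a →
            d₁ * d₂ * ((T - I) + (Q - I) * (A - I)) ≈
            d₂ * t - d₁ * d₂ + (Q - I) * (d₁ * a - d₁ * d₂)
  combine d₁ d₂ Q T A t a eT eA = begin
    d₁ * d₂ * ((T - I) + (Q - I) * (A - I))
      ≈⟨ solve 5 (λ d₁ d₂ Q T A → d₁ :* d₂ :* ((T :- c1) :+ (Q :- c1) :* (A :- c1)) :=
           d₂ :* (d₁ :* T) :- d₁ :* d₂ :+ (Q :- c1) :* (d₁ :* (d₂ :* A) :- d₁ :* d₂)) ≈-refl d₁ d₂ Q T A ⟩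
    d₂ * (d₁ * T) - d₁ * d₂ + (Q - I) * (d₁ * (d₂ * A) - d₁ * d₂)
      ≈⟨ +-cong (+-congʳ (*-congˡ eT)) (*-congˡ (+-congʳ (*-congˡ eA))) ⟩
    d₂ * t - d₁ * d₂ + (Q - I) * (d₁ * a - d₁ * d₂) ∎

  -- The shape of `Num k`, for p = X^(k+1), y = X^(2⌊k/2⌋) and z = X^(2⌊(k-1)/2⌋).
  numerator : Carrier → Carrier → Carrier → Carrier → Carrier → Carrier
  numerator X Q p y z = X * ((I - X) * X * (I - z) - Q * (I + X) * D₁ X p * (κ (ℤ.- (+ 2)) + X + y))

  private
    numeratorᴾ : ∀ {n} (X Q p y z : Polynomial n) → Polynomial n
    numeratorᴾ X Q p y z =
      X :* ((c1 :- X) :* X :* (c1 :- z) :- Q :* (c1 :+ X) :* D₁ᴾ X p :* (c-2 :+ X :+ y))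

    combinedᴾ : ∀ {n} (d₁ d₂ Q t a : Polynomial n) → Polynomial n
    combinedᴾ d₁ d₂ Q t a = d₂ :* t :- d₁ :* d₂ :+ (Q :- c1) :* (d₁ :* a :- d₁ :* d₂)

  -- Here z stands for X^(k-2) with k even.
  numerator-even : ∀ X Q z → let y = X * (X * z); d₁ = D₁ X (X * y); d₂ = D₂ X (X * (X * y)) in
    d₂ * (I - y) - d₁ * d₂ + (Q - I) * (d₁ * (I - X * X + X * (I - y)) - d₁ * d₂) ≈
    numerator X Q (X * y) y z
  numerator-even = solve 3 (λ X Q z → let y = X :* (X :* z) in
    combinedᴾ (D₁ᴾ X (X :* y)) (D₂ᴾ X (X :* (X :* y))) Q (c1 :- y) (c1 :- X :* X :+ X :* (c1 :- y)) :=
    numeratorᴾ X Q (X :* y) y z) ≈-refl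

  -- Here y stands for X^(k-1) with k odd.
  numerator-odd : ∀ X Q y → let p = X * y; d₁ = D₁ X (X * p); d₂ = D₂ X (X * (X * y)) in
    d₂ * (I - p) - d₁ * d₂ + (Q - I) * (d₁ * (I - X * X + X * (I - y)) - d₁ * d₂) ≈
    numerator X Q (X * p) y y
  numerator-odd = solve 3 (λ X Q y → let p = X :* y in
    combinedᴾ (D₁ᴾ X (X :* p)) (D₂ᴾ X (X :* (X :* y))) Q (c1 :- p) (c1 :- X :* X :+ X :* (c1 :- y)) :=
    numeratorᴾ X Q (X :* p) y y) ≈-refl

  split-Q : ∀ Q T A → T + (Q - I) * A ≈ T + (Q * A - A)
  split-Q = solve 3 (λ Q T A → T :+ (Q :- c1) :* A := T :+ (Q :* A :- A)) ≈-refl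

-- A pigeonhole principle for lists

unique⊆⇒length≤ : ∀ {A : Set} {xs ys : List A} → Unique xs → (∀ {x} → x ∈ xs → x ∈ ys) →
                  length xs ≤ length ys
unique⊆⇒length≤ []        sub = z≤n
unique⊆⇒length≤ {xs = x ∷ xs} (x∉xs ∷ u) sub with ∈-∃++ (sub (here refl))
-- The occurrence of `x` is cut out of `ys`; as `x` does not recur in `xs`, the rest of `xs` stays
-- inside what remains.
... | as , bs , refl = subst (suc (length xs) ≤_) (sym (trans (length-++ as)
                         (trans (ℕ.+-suc (length as) (length bs)) (cong suc (sym (length-++ as))))))
                         (s≤s (unique⊆⇒length≤ u sub′))
  where
    sub′ : ∀ {z} → z ∈ xs → z ∈ as ++ bs
    sub′ z∈ with ∈-++⁻ as (sub (there z∈))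
    ... | inj₁ p         = ∈-++⁺ˡ p
    ... | inj₂ (here refl) = ⊥-elim (All.lookup x∉xs z∈ refl)
    ... | inj₂ (there p) = ∈-++⁺ʳ as p

-- Toughness

-- class sends the vertices of a cut set to nothing and every other vertex to a
-- name of its component in the complement of the cut set.

module Toughness {V K : Set} (E : V → V → Set) (class : V → Maybe K)
  (class-edge : ∀ {u v c d} → E u v → class u ≡ just c → class v ≡ just d → c ≡ d)
  where

  cut? : ∀ v → Dec (class v ≡ nothing)
  cut? v with class v
  ... | nothing = yes refl
  ... | just _  = no λ ()

  -- A component is recorded whenever the walk steps from it into the cut set. Each record is
  -- charged to the cut vertex entered, which bounds their number.
  exit : Maybe K → Maybe K → List K → List K
  exit (just c) nothing cs = c ∷ cs
  exit _        _       cs = cs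

  exits : List V → List K
  exits []          = []
  exits (u ∷ [])    = []
  exits (u ∷ v ∷ l) = exit (class u) (class v) (exits (v ∷ l))

  length-exits : ∀ u l → length (exits (u ∷ l)) ≤ length (filter cut? l)
  length-exits u []      = z≤n
  length-exits u (v ∷ l) with class u | class v | length-exits v l
  ... | just _  | nothing | ih = s≤s ih
  ... | nothing | nothing | ih = ℕ.m≤n⇒m≤1+n ih
  ... | just _  | just _  | ih = ih
  ... | nothing | just _  | ih = ih

  exit⁺ : ∀ {c} a b {cs} → c ∈ cs → c ∈ exit a b cs
  exit⁺ (just _) nothing  p = there p
  exit⁺ (just _) (just _) p = p
  exit⁺ nothing  _        p = p

  -- Outside the cut set an edge never changes the component, so the first cut vertex met, if any,
  -- is entered from c.
  head-exits : ∀ {c} u l → Linked E (u ∷ l) → class u ≡ just c →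
               c ∈ exits (u ∷ l) ⊎ All (λ v → class v ≡ just c) (u ∷ l)
  head-exits u []      _       eq = inj₂ (eq ∷ [])
  head-exits {c} u (v ∷ l) (e ∷ es) eq with class v in eqv
  ... | nothing rewrite eq = inj₁ (here refl)
  ... | just d with refl ← class-edge e eq eqv with head-exits v l es eqv
  ...   | inj₁ p = inj₁ (exit⁺ (class u) (just d) p)
  ...   | inj₂ p = inj₂ (eq ∷ p)

  last-exits : ∀ {c x} l v → Linked E (l ++ [ v ]) → x ∈ l ++ [ v ] → class x ≡ just c →
               c ∈ exits (l ++ [ v ]) ⊎ class v ≡ just c
  last-exits [] v es (here refl) eq = inj₂ eq
  last-exits (u ∷ l) v es (here refl) eq with head-exits u (l ++ [ v ]) es eq
  ... | inj₁ p = inj₁ p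
  ... | inj₂ p = inj₂ (All.lookup p (there (∈-++⁺ʳ l (here refl))))
  last-exits (u ∷ []) v es (there (here refl)) eq = inj₂ eq
  last-exits (u ∷ l@(u′ ∷ _)) v (_ ∷ es) (there x∈) eq with last-exits l v es x∈ eq
  ... | inj₁ p = inj₁ (exit⁺ (class u) (class u′) p)
  ... | inj₂ p = inj₂ p

  -- A closed walk that meets both a component and the cut set must at some point step from the one
  -- into the other. Distinct components yield distinct exits, and each exit uses up a cut vertex.
  components≤cut : ∀ v vs → Linked E (v ∷ vs ++ [ v ]) → ∀ {s} → s ∈ v ∷ vs → class s ≡ nothing →
    ∀ reps → Unique reps → (∀ {c} → c ∈ reps → ∃[ x ] (x ∈ v ∷ vs × class x ≡ just c)) →
    length reps ≤ length (filter cut? (v ∷ vs))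
  components≤cut v vs es s∈ s-cut reps u visited = begin
    length reps                         ≤⟨ unique⊆⇒length≤ u every-exit ⟩
    length (exits (v ∷ vs ++ [ v ]))    ≤⟨ length-exits v (vs ++ [ v ]) ⟩
    length (filter cut? (vs ++ [ v ]))  ≡⟨ rotate ⟩
    length (filter cut? (v ∷ vs))       ∎
    where
      open ℕ.≤-Reasoning
      -- Exits are charged to the vertex entered, so `v` counts at the end of the walk and not at
      -- its beginning.
      rotate : length (filter cut? (vs ++ [ v ])) ≡ length (filter cut? (v ∷ vs))
      rotate = trans (cong length (filter-++ cut? vs [ v ]))
              (trans (length-++ (filter cut? vs))
              (trans (ℕ.+-comm _ (length (filter cut? [ v ])))
              (trans (sym (length-++ (filter cut? [ v ])))
                     (cong length (sym (filter-++ cut? [ v ] vs))))))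

      every-exit : ∀ {c} → c ∈ reps → c ∈ exits (v ∷ vs ++ [ v ])
      every-exit c∈ with visited c∈
      ... | x , x∈ , eq with last-exits (v ∷ vs) v es (∈-++⁺ˡ x∈) eq
      ... | inj₁ p = p
      -- The walk from `x` ends at `v` inside the component, so it is resumed from the start; never
      -- leaving then contradicts the cut vertex `s`.
      ... | inj₂ eqv with head-exits v (vs ++ [ v ]) es eqv
      ... | inj₁ p = p
      ... | inj₂ p with trans (sym s-cut) (All.lookup p (∈-++⁺ˡ s∈))
      ... | ()

-- Even runs exclude Hamiltonian cycles

even : ℕ → Bool
even zero    = true
even (suc n) = not (even n)

double : ℕ → ℕ
double zero    = 0
double (suc s) = suc (suc (double s))

-- For a = 0 the field `before` is vacuous, and `after` allows height 0, so runs at either end of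
-- the word are included.
record EvenRun (w : List Bool) (a s : ℕ) : Set where
  field
    tall   : ∀ i → i < double s → heightAt w (i ℕ.+ a) ≡ 2
    before : ∀ i → suc i ≡ a → heightAt w i ≤ 1
    after  : heightAt w (double s ℕ.+ a) ≤ 1

-- The two colour classes of the 3 × (2s+1) grid with left side in column a.
blacks whites : ℕ → ℕ → List Point
blacks a zero    = (a , 0) ∷ (a , 2) ∷ []
blacks a (suc s) = (a , 0) ∷ (a , 2) ∷ (suc a , 1) ∷ blacks (suc (suc a)) s
whites a zero    = (a , 1) ∷ []
whites a (suc s) = (a , 1) ∷ (suc a , 0) ∷ (suc a , 2) ∷ whites (suc (suc a)) s

length-blacks : ∀ a s → length (blacks a s) ≡ suc (length (whites a s))
length-blacks a zero    = refl
length-blacks a (suc s) = cong (suc ∘ suc ∘ suc) (length-blacks _ s)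

blacks-right : ∀ a s → All (λ p → a ≤ proj₁ p) (blacks a s)
blacks-right a zero    = ℕ.≤-refl ∷ ℕ.≤-refl ∷ []
blacks-right a (suc s) = ℕ.≤-refl ∷ ℕ.≤-refl ∷ ℕ.n≤1+n a ∷
  All.map (ℕ.≤-trans (ℕ.m≤n+m a 2)) (blacks-right (suc (suc a)) s)

blacks-unique : ∀ a s → Unique (blacks a s)
blacks-unique a zero    = ((λ ()) ∷ []) ∷ [] ∷ []
blacks-unique a (suc s) =
  ((λ ()) ∷ (λ ()) ∷ All.map (new (ℕ.m≤n+m (suc a) 1)) rest) ∷
  ((λ ()) ∷ All.map (new (ℕ.m≤n+m (suc a) 1)) rest) ∷
  All.map (new ℕ.≤-refl) rest ∷ blacks-unique (suc (suc a)) s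
  where
    rest : All (λ p → suc (suc a) ≤ proj₁ p) (blacks (suc (suc a)) s)
    rest = blacks-right (suc (suc a)) s

    new : ∀ {b x y} {p : Point} → suc x ≤ b → b ≤ proj₁ p → (x , y) ≢ p
    new lt le refl = ℕ.<-irrefl refl (ℕ.≤-trans lt le)

shift₂ : ∀ d a → d ℕ.+ suc (suc a) ≡ suc (suc (d ℕ.+ a))
shift₂ d a = trans (ℕ.+-suc d (suc a)) (cong suc (ℕ.+-suc d a))

blacks⁻ : ∀ a s {p} → p ∈ blacks a s → ∃[ d ] ∃[ y ]
          (p ≡ (d ℕ.+ a , y) × d ≤ double s × y ≤ 2 × even (d ℕ.+ y) ≡ true)
blacks⁻ a zero (here refl)         = 0 , 0 , refl , z≤n , z≤n , refl
blacks⁻ a zero (there (here refl)) = 0 , 2 , refl , z≤n , ℕ.≤-refl , refl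
blacks⁻ a (suc s) (here refl)                 = 0 , 0 , refl , z≤n , z≤n , refl
blacks⁻ a (suc s) (there (here refl))         = 0 , 2 , refl , z≤n , ℕ.≤-refl , refl
blacks⁻ a (suc s) (there (there (here refl))) = 1 , 1 , refl , s≤s z≤n , s≤s z≤n , refl
blacks⁻ a (suc s) (there (there (there p∈))) with blacks⁻ (suc (suc a)) s p∈
... | d , y , refl , d≤ , y≤ , ev =
  suc (suc d) , y , cong (_, y) (shift₂ d a) , s≤s (s≤s d≤) , y≤ , trans (not-involutive _) ev

whites⁺ : ∀ a s d y → d ≤ double s → y ≤ 2 → even (d ℕ.+ y) ≡ false → (d ℕ.+ a , y) ∈ whites a s
whites⁺ a zero    zero 1 _ _ _ = here refl
whites⁺ a zero    zero 0 _ _ ()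
whites⁺ a zero    zero 2 _ _ ()
whites⁺ a zero    zero (suc (suc (suc y))) _ (s≤s (s≤s ())) _
whites⁺ a (suc s) zero 1 _ _ _ = here refl
whites⁺ a (suc s) zero 0 _ _ ()
whites⁺ a (suc s) zero 2 _ _ ()
whites⁺ a (suc s) zero (suc (suc (suc y))) _ (s≤s (s≤s ())) _
whites⁺ a (suc s) 1 0 _ _ _ = there (here refl)
whites⁺ a (suc s) 1 2 _ _ _ = there (there (here refl))
whites⁺ a (suc s) 1 1 _ _ ()
whites⁺ a (suc s) 1 (suc (suc (suc y))) _ (s≤s (s≤s ())) _
whites⁺ a (suc s) (suc (suc d)) y (s≤s (s≤s d≤)) y≤ ev =
  there (there (there (subst (λ x → (x , y) ∈ whites (suc (suc a)) s) (shift₂ d a)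
    (whites⁺ (suc (suc a)) s d y d≤ y≤ (trans (sym (not-involutive _)) ev)))))

heightAt≤2 : ∀ w i → heightAt w i ≤ 2
heightAt≤2 []          i       = z≤n
heightAt≤2 (false ∷ w) zero    = s≤s z≤n
heightAt≤2 (true ∷ w)  zero    = ℕ.≤-refl
heightAt≤2 (false ∷ w) (suc i) = heightAt≤2 w i
heightAt≤2 (true ∷ w)  (suc i) = heightAt≤2 w i

vertex-height : ∀ {w x y} → IsVertex w (x , y) → y ≤ 2
vertex-height {w} (i , j , cell , _ , inj₁ refl) = ℕ.≤-trans (ℕ.<⇒≤ cell) (heightAt≤2 w i)
vertex-height {w} (i , j , cell , _ , inj₂ refl) = ℕ.≤-trans cell (heightAt≤2 w i)

-- On the left and right sides of the grid, the one black point of height at most 1 is the bottom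
-- corner.
even-double : ∀ s {y} → y ≤ 1 → even (double s ℕ.+ y) ≡ true → y ≡ 0
even-double zero    {zero} _ _ = refl
even-double zero    {1} _ ()
even-double zero    {suc (suc y)} (s≤s ()) _
even-double (suc s) y≤1 e = even-double s y≤1 (trans (sym (not-involutive _)) e)

tall-vertex : ∀ w {i x y} → heightAt w i ≡ 2 → x ≡ i ⊎ x ≡ suc i → y ≤ 2 → IsVertex w (x , y)
tall-vertex w {i} {y = zero}  h x∈ _  = i , 0 , subst (0 <_) (sym h) (s≤s z≤n) , x∈ , inj₁ refl
tall-vertex w {i} {y = suc y} h x∈ y≤ = i , y , subst (y <_) (sym h) y≤ , x∈ , inj₂ refl

-- Components left after deleting the white points

module _ (w : List Bool) (a s : ℕ) where

  -- Each part outside the grid bears the name of the bottom corner on its side, the only black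
  -- point it touches. Every black grid point names its own component.
  class : Point → Maybe Point
  class (x , y) with x ℕ.<? a
  ... | yes _ = just (a , 0)
  ... | no _ with double s ℕ.<? (x ℕ.∸ a)
  ...   | yes _ = just (double s ℕ.+ a , 0)
  ...   | no _  = if even ((x ℕ.∸ a) ℕ.+ y) then just (x , y) else nothing

  -- The cases of `class` with the column written as d + a, which spares later proofs the truncated
  -- subtraction.
  data View : Point → Maybe Point → Set where
    left  : ∀ {x y} → x < a → View (x , y) (just (a , 0))
    right : ∀ {x y} d → x ≡ d ℕ.+ a → double s < d → View (x , y) (just (double s ℕ.+ a , 0))
    black : ∀ {x y} d → x ≡ d ℕ.+ a → d ≤ double s → even (d ℕ.+ y) ≡ true → View (x , y) (just (x , y))
    white : ∀ {x y} d → x ≡ d ℕ.+ a → d ≤ double s → even (d ℕ.+ y) ≡ false → View (x , y) nothing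

  view : ∀ p → View p (class p)
  view (x , y) with x ℕ.<? a
  ... | yes x<a = left x<a
  ... | no x≮a with double s ℕ.<? (x ℕ.∸ a)
  ...   | yes lt = right (x ℕ.∸ a) (sym (ℕ.m∸n+n≡m (ℕ.≮⇒≥ x≮a))) lt
  ...   | no ≮ with even ((x ℕ.∸ a) ℕ.+ y) in ev
  ...     | true  = black (x ℕ.∸ a) (sym (ℕ.m∸n+n≡m (ℕ.≮⇒≥ x≮a))) (ℕ.≮⇒≥ ≮) ev
  ...     | false = white (x ℕ.∸ a) (sym (ℕ.m∸n+n≡m (ℕ.≮⇒≥ x≮a))) (ℕ.≮⇒≥ ≮) ev

  view-unique : ∀ {p m m′} → View p m → View p m′ → m ≡ m′
  view-unique (left _)  (left _) = refl
  view-unique (left lt) (right d refl _)   = ⊥-elim (ℕ.<⇒≱ lt (ℕ.m≤n+m a d))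
  view-unique (left lt) (black d refl _ _) = ⊥-elim (ℕ.<⇒≱ lt (ℕ.m≤n+m a d))
  view-unique (left lt) (white d refl _ _) = ⊥-elim (ℕ.<⇒≱ lt (ℕ.m≤n+m a d))
  view-unique (right d refl _) (left lt)   = ⊥-elim (ℕ.<⇒≱ lt (ℕ.m≤n+m a d))
  view-unique (right _ _ _) (right _ _ _)  = refl
  view-unique (right d refl lt) (black d′ eq le _) with refl ← ℕ.+-cancelʳ-≡ a d d′ eq = ⊥-elim (ℕ.<⇒≱ lt le)
  view-unique (right d refl lt) (white d′ eq le _) with refl ← ℕ.+-cancelʳ-≡ a d d′ eq = ⊥-elim (ℕ.<⇒≱ lt le)
  view-unique (black d refl _ _) (left lt)   = ⊥-elim (ℕ.<⇒≱ lt (ℕ.m≤n+m a d))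
  view-unique (black d refl le _) (right d′ eq lt) with refl ← ℕ.+-cancelʳ-≡ a d d′ eq = ⊥-elim (ℕ.<⇒≱ lt le)
  view-unique (black _ _ _ _) (black _ _ _ _) = refl
  view-unique (black d refl _ e) (white d′ eq _ e′) with refl ← ℕ.+-cancelʳ-≡ a d d′ eq with () ← trans (sym e) e′
  view-unique (white d refl _ _) (left lt)   = ⊥-elim (ℕ.<⇒≱ lt (ℕ.m≤n+m a d))
  view-unique (white d refl le _) (right d′ eq lt) with refl ← ℕ.+-cancelʳ-≡ a d d′ eq = ⊥-elim (ℕ.<⇒≱ lt le)
  view-unique (white d refl _ e) (black d′ eq _ e′) with refl ← ℕ.+-cancelʳ-≡ a d d′ eq with () ← trans (sym e) e′
  view-unique (white _ _ _ _) (white _ _ _ _) = refl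

  class-view : ∀ {p m} → View p m → class p ≡ m
  class-view v = view-unique (view _) v

  module _ (run : EvenRun w a s) where
    open EvenRun run

    -- Vertical neighbours in the grid have opposite colours, so one of them is cut.
    vertical : ∀ {x y p q} → View (x , y) (just p) → View (x , suc y) (just q) → p ≡ q
    vertical (left _)  (left _) = refl
    vertical (left lt) (right d refl _)   = ⊥-elim (ℕ.<⇒≱ lt (ℕ.m≤n+m a d))
    vertical (left lt) (black d refl _ _) = ⊥-elim (ℕ.<⇒≱ lt (ℕ.m≤n+m a d))
    vertical (right d refl _) (left lt)   = ⊥-elim (ℕ.<⇒≱ lt (ℕ.m≤n+m a d))
    vertical (right _ _ _) (right _ _ _)  = refl
    vertical (right d refl lt) (black d′ eq le _) with refl ← ℕ.+-cancelʳ-≡ a d d′ eq = ⊥-elim (ℕ.<⇒≱ lt le)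
    vertical (black d refl _ _) (left lt)   = ⊥-elim (ℕ.<⇒≱ lt (ℕ.m≤n+m a d))
    vertical (black d refl le _) (right d′ eq lt) with refl ← ℕ.+-cancelʳ-≡ a d d′ eq = ⊥-elim (ℕ.<⇒≱ lt le)
    vertical {y = y} (black d refl _ e) (black d′ eq _ e′) with refl ← ℕ.+-cancelʳ-≡ a d d′ eq
      = ⊥-elim (not-¬ refl (trans e (sym (subst (λ n → even n ≡ true) (ℕ.+-suc d y) e′))))

    -- Inside the grid, colours alternate. An edge crossing the left or right side of the grid
    -- borders a column of height at most 1, so by parity its uncut grid end is the bottom corner,
    -- which names the outside part too.
    horizontal : ∀ {x y p q} → (heightAt w x ≤ 1 → y ≤ 1) →
                 View (x , y) (just p) → View (suc x , y) (just q) → p ≡ q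
    horizontal low (left _) (left _) = refl
    horizontal low (left lt) (right zero eq ())
    horizontal low (left lt) (right (suc d) refl _) = ⊥-elim (ℕ.<⇒≱ lt (ℕ.m≤n+m a d))
    horizontal low (left lt) (black zero refl _ e) with refl ← even-double 0 (low (before _ refl)) e = refl
    horizontal low (left lt) (black (suc d) refl _ _) = ⊥-elim (ℕ.<⇒≱ lt (ℕ.m≤n+m a d))
    horizontal low (right d refl _) (left lt) = ⊥-elim (ℕ.<⇒≱ lt (ℕ.≤-trans (ℕ.m≤n+m a d) (ℕ.n≤1+n _)))
    horizontal low (right _ _ _) (right _ _ _) = refl
    horizontal low (right d refl lt) (black d′ eq le _) with refl ← ℕ.+-cancelʳ-≡ a (suc d) d′ eq
      = ⊥-elim (ℕ.<⇒≱ lt (ℕ.≤-trans (ℕ.n≤1+n d) le))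
    horizontal low (black d refl _ _) (left lt) = ⊥-elim (ℕ.<⇒≱ lt (ℕ.≤-trans (ℕ.m≤n+m a d) (ℕ.n≤1+n _)))
    horizontal low (black d refl le e) (right d′ eq lt) with refl ← ℕ.+-cancelʳ-≡ a (suc d) d′ eq
      with refl ← ℕ.≤-antisym le (ℕ.s≤s⁻¹ lt)
      with refl ← even-double s (low after) e = refl
    horizontal low (black d refl _ e) (black d′ eq _ e′) with refl ← ℕ.+-cancelʳ-≡ a (suc d) d′ eq
      = ⊥-elim (not-¬ refl (trans e (sym e′)))

    side-views : ∀ {i j u v p q} → Cell w i j → Side i j u v →
                 View u (just p) → View v (just q) → p ≡ q
    side-views cell bottom = horizontal λ low → ℕ.≤-trans (ℕ.<⇒≤ cell) low
    side-views cell top    = horizontal λ low → ℕ.≤-trans cell low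
    side-views cell left   = vertical
    side-views cell right  = vertical

    class-edge : ∀ {u v p q} → Edge w u v → class u ≡ just p → class v ≡ just q → p ≡ q
    class-edge {u} {v} (i , j , cell , side) eu ev with subst (View u) eu (view u) | subst (View v) ev (view v) | side
    ... | vu | vv | inj₁ sd = side-views cell sd vu vv
    ... | vu | vv | inj₂ sd = sym (side-views cell sd vv vu)

    open Toughness (Edge w) class class-edge

    strip-vertex : ∀ d y → d ≤ double s → 0 < s → y ≤ 2 → IsVertex w (d ℕ.+ a , y)
    strip-vertex d y d≤ 0<s y≤2 with ℕ.m≤n⇒m<n∨m≡n d≤
    ... | inj₁ d<   = tall-vertex w (tall d d<) (inj₁ refl) y≤2
    -- The right side of the grid belongs to the last column of the run, which exists as s > 0.
    ... | inj₂ refl = last s 0<s tall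
      where
        last : ∀ s → 0 < s → (∀ i → i < double s → heightAt w (i ℕ.+ a) ≡ 2) → IsVertex w (double s ℕ.+ a , y)
        last (suc s) _ tall = tall-vertex w (tall (suc (double s)) ℕ.≤-refl) (inj₂ refl) y≤2

    -- The cycle visits every black point, hence as many components; its cut vertices are distinct
    -- white points, one fewer than the black ones. The white point (a , 1) shows that the cycle
    -- meets the cut set.
    evenRun⇒¬ham : 0 < s → ¬ HasHamCycle w
    evenRun⇒¬ham 0<s (v , vs , _ , unique , vertices , complete , walk) =
      ℕ.<-irrefl refl (begin-strict
        length (whites a s)           <⟨ ℕ.≤-reflexive (sym (length-blacks a s)) ⟩
        length (blacks a s)           ≤⟨ components≤cut v vs walk (complete (a , 1) (strip-vertex 0 1 z≤n 0<s (s≤s z≤n)))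
                                           (class-view (white 0 refl z≤n refl)) (blacks a s) (blacks-unique a s) visited ⟩
        length (filter cut? (v ∷ vs)) ≤⟨ unique⊆⇒length≤ (filter⁺ cut? unique) cut⊆ ⟩
        length (whites a s)           ∎)
      where
        open ℕ.≤-Reasoning
        visited : ∀ {c} → c ∈ blacks a s → ∃[ x ] (x ∈ v ∷ vs × class x ≡ just c)
        visited c∈ with blacks⁻ a s c∈
        ... | d , y , refl , d≤ , y≤ , ev =
          _ , complete _ (strip-vertex d y d≤ 0<s y≤) , class-view (black d refl d≤ ev)

        cut⊆ : ∀ {x} → x ∈ filter cut? (v ∷ vs) → x ∈ whites a s
        cut⊆ {x} x∈ with ∈-filter⁻ cut? {xs = v ∷ vs} x∈
        ... | x∈′ , eq with subst (View x) eq (view x)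
        ... | white d refl d≤ ev = whites⁺ a s d _ d≤ (vertex-height {w} (All.lookup vertices x∈′)) ev

-- Locating an even run

data Phase : Set where
  fresh odd even⁺ : Phase

-- The phase records the run of 1s that precedes the word: empty, of odd
-- length, or of positive even length.
oddRuns : Phase → List Bool → Bool
oddRuns fresh []          = true
oddRuns odd   []          = true
oddRuns even⁺ []          = false
oddRuns fresh (false ∷ w) = oddRuns fresh w
oddRuns odd   (false ∷ w) = oddRuns fresh w
oddRuns even⁺ (false ∷ w) = false
oddRuns fresh (true ∷ w)  = oddRuns odd w
oddRuns odd   (true ∷ w)  = oddRuns even⁺ w
oddRuns even⁺ (true ∷ w)  = oddRuns odd w

heightAt-suc : ∀ b w i → heightAt (b ∷ w) (suc i) ≡ heightAt w i
heightAt-suc false w i = refl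
heightAt-suc true  w i = refl

InitialRun : List Bool → ℕ → Set
InitialRun w n = (∀ i → i < n → heightAt w i ≡ 2) × heightAt w n ≤ 1

initialRun-∷ : ∀ {w n} → InitialRun w n → InitialRun (true ∷ w) (suc n)
initialRun-∷ (tall , low) = (λ { zero _ → refl ; (suc i) (s≤s i<) → tall i i< }) , low

evenRun-initial : ∀ {w} s → InitialRun w (double s) → EvenRun w 0 s
evenRun-initial {w} s (tall , low) = record
  { tall   = λ i i< → trans (cong (heightAt w) (ℕ.+-identityʳ i)) (tall i i<)
  ; before = λ _ ()
  ; after  = subst (λ n → heightAt w n ≤ 1) (sym (ℕ.+-identityʳ (double s))) low
  }

evenRun-∷ : ∀ {b w a s} → (a ≡ 0 → heightAt (b ∷ w) 0 ≤ 1) → EvenRun w a s → EvenRun (b ∷ w) (suc a) s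
evenRun-∷ {b} {w} {a} {s} low run = record
  { tall   = λ i i< → trans (shift i) (tall i i<)
  ; before = λ { zero refl → low refl
               ; (suc i) refl → subst (_≤ 1) (sym (heightAt-suc b w i)) (before i refl) }
  ; after  = subst (_≤ 1) (sym (shift (double s))) after
  }
  where
    open EvenRun run
    shift : ∀ i → heightAt (b ∷ w) (i ℕ.+ suc a) ≡ heightAt w (i ℕ.+ a)
    shift i = trans (cong (heightAt (b ∷ w)) (ℕ.+-suc i a)) (heightAt-suc b w (i ℕ.+ a))

-- A run that starts after column 0 remains maximal when any letter is prepended.
InteriorEvenRun : List Bool → Set
InteriorEvenRun w = ∃[ a ] ∃[ s ] (0 < s × EvenRun w (suc a) s)

interior-∷ : ∀ {b w} → InteriorEvenRun w → InteriorEvenRun (b ∷ w)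
interior-∷ (a , s , 0<s , run) = suc a , s , 0<s , evenRun-∷ (λ ()) run

-- In phases `odd` and `even⁺` a run is already under way. Either its remainder, odd or even
-- respectively, makes its total length even, or the even run lies further right.
find-fresh : ∀ w → oddRuns fresh w ≡ false → ∃[ a ] ∃[ s ] (0 < s × EvenRun w a s)
find-odd   : ∀ w → oddRuns odd w ≡ false → (∃[ s ] InitialRun w (suc (double s))) ⊎ InteriorEvenRun w
find-even⁺ : ∀ w → oddRuns even⁺ w ≡ false → (∃[ s ] InitialRun w (double s)) ⊎ InteriorEvenRun w

find-fresh (false ∷ w) eq with find-fresh w eq
... | a , s , 0<s , run = suc a , s , 0<s , evenRun-∷ (λ _ → ℕ.≤-refl) run
find-fresh (true ∷ w) eq with find-odd w eq
... | inj₁ (s , init) = 0 , suc s , s≤s z≤n , evenRun-initial (suc s) (initialRun-∷ init)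
... | inj₂ (a , s , 0<s , run) = suc (suc a) , s , 0<s , evenRun-∷ (λ ()) run

find-odd (false ∷ w) eq with find-fresh w eq
... | a , s , 0<s , run = inj₂ (a , s , 0<s , evenRun-∷ (λ _ → ℕ.≤-refl) run)
find-odd (true ∷ w) eq with find-even⁺ w eq
... | inj₁ (s , init) = inj₁ (s , initialRun-∷ init)
... | inj₂ int        = inj₂ (interior-∷ int)

find-even⁺ []          eq = inj₁ (0 , (λ _ ()) , z≤n)
find-even⁺ (false ∷ w) eq = inj₁ (0 , (λ _ ()) , ℕ.≤-refl)
find-even⁺ (true ∷ w)  eq with find-odd w eq
... | inj₁ (s , init) = inj₁ (suc s , initialRun-∷ init)
... | inj₂ int        = inj₂ (interior-∷ int)

¬oddRuns⇒¬ham : ∀ w → oddRuns fresh w ≡ false → ¬ HasHamCycle w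
¬oddRuns⇒¬ham w eq with find-fresh w eq
... | a , s , 0<s , run = evenRun⇒¬ham w a s run 0<s

-- Hamiltonian cycles when all runs are odd

-- The way back, from right to left, ending next to the starting vertex (0 , 1).
bottomRow : ℕ → List Point
bottomRow zero    = (0 , 0) ∷ []
bottomRow (suc i) = (suc i , 0) ∷ bottomRow i

-- The part of the cycle after (i , 1), when w is the word from column i on.
-- A letter 1 is processed together with its successor: if that is 0, the run is
-- over; if it is 1, then a further 1 follows (runs being odd) and starts the
-- next tooth.
zigzag : ℕ → List Bool → List Point
zigzag i []           = bottomRow i
zigzag i (false ∷ w)  = (suc i , 1) ∷ zigzag (suc i) w
zigzag i (true ∷ [])  = (i , 2) ∷ (suc i , 2) ∷ (suc i , 1) ∷ bottomRow (suc i)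
zigzag i (true ∷ _ ∷ w) =
  (i , 2) ∷ (suc i , 2) ∷ (suc i , 1) ∷ (suc (suc i) , 1) ∷ zigzag (suc (suc i)) w

bottomRow-bound : ∀ i → All (λ p → proj₁ p ≤ i × proj₂ p ≡ 0) (bottomRow i)
bottomRow-bound zero    = (z≤n , refl) ∷ []
bottomRow-bound (suc i) = (ℕ.≤-refl , refl) ∷ All.map (λ (le , eq) → ℕ.m≤n⇒m≤1+n le , eq) (bottomRow-bound i)

bottomRow-unique : ∀ i → Unique (bottomRow i)
bottomRow-unique zero    = [] ∷ []
bottomRow-unique (suc i) = All.map (λ { (le , _) refl → ℕ.<-irrefl refl le }) (bottomRow-bound i) ∷ bottomRow-unique i

-- Separates the rest of the cycle from the vertices already passed, which lie left of column i and
-- above the bottom line.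
RightOrBottom : ℕ → Point → Set
RightOrBottom i (x , y) = i ≤ x ⊎ y ≡ 0

rightOrBottom-mono : ∀ {i j} p → i ≤ j → RightOrBottom j p → RightOrBottom i p
rightOrBottom-mono p i≤j (inj₁ le) = inj₁ (ℕ.≤-trans i≤j le)
rightOrBottom-mono p i≤j (inj₂ eq) = inj₂ eq

zigzag-bound : ∀ i w → All (RightOrBottom i) (zigzag i w)
zigzag-bound i []           = All.map (λ (_ , eq) → inj₂ eq) (bottomRow-bound i)
zigzag-bound i (false ∷ w)  = inj₁ (ℕ.n≤1+n i) ∷ All.map (rightOrBottom-mono _ (ℕ.n≤1+n i)) (zigzag-bound (suc i) w)
zigzag-bound i (true ∷ [])  = inj₁ ℕ.≤-refl ∷ inj₁ (ℕ.n≤1+n i) ∷ inj₁ (ℕ.n≤1+n i) ∷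
  All.map (λ (_ , eq) → inj₂ eq) (bottomRow-bound (suc i))
zigzag-bound i (true ∷ _ ∷ w) = inj₁ ℕ.≤-refl ∷ inj₁ (ℕ.n≤1+n i) ∷ inj₁ (ℕ.n≤1+n i) ∷ inj₁ (ℕ.m≤n+m i 2) ∷
  All.map (rightOrBottom-mono _ (ℕ.m≤n+m i 2)) (zigzag-bound (suc (suc i)) w)

fresh-point : ∀ {x y i l} → x < i → All (RightOrBottom i) l → All ((x , suc y) ≢_) l
fresh-point x<i = All.map λ { (inj₁ le) refl → ℕ.<⇒≱ x<i le ; (inj₂ ()) refl }

cycle-unique : ∀ i w → Unique ((i , 1) ∷ zigzag i w)
cycle-unique i []          = All.map (λ { (_ , ()) refl }) (bottomRow-bound i) ∷ bottomRow-unique i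
cycle-unique i (false ∷ w) = ((λ ()) ∷ fresh-point ℕ.≤-refl (zigzag-bound (suc i) w)) ∷ cycle-unique (suc i) w
cycle-unique i (true ∷ []) =
  ((λ ()) ∷ (λ ()) ∷ (λ ()) ∷ offBottom) ∷ ((λ ()) ∷ (λ ()) ∷ offBottom) ∷
  ((λ ()) ∷ offBottom) ∷ cycle-unique (suc i) []
  where
    offBottom : ∀ {x y} → All ((x , suc y) ≢_) (bottomRow (suc i))
    offBottom = All.map (λ { (_ , ()) refl }) (bottomRow-bound (suc i))
cycle-unique i (true ∷ _ ∷ w) =
  ((λ ()) ∷ (λ ()) ∷ (λ ()) ∷ (λ ()) ∷ off (ℕ.m≤n+m (suc i) 1)) ∷
  ((λ ()) ∷ (λ ()) ∷ (λ ()) ∷ off (ℕ.m≤n+m (suc i) 1)) ∷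
  ((λ ()) ∷ (λ ()) ∷ off ℕ.≤-refl) ∷ ((λ ()) ∷ off ℕ.≤-refl) ∷ cycle-unique (suc (suc i)) w
  where
    off : ∀ {x y} → x < suc (suc i) → All ((x , suc y) ≢_) (zigzag (suc (suc i)) w)
    off lt = fresh-point lt (zigzag-bound (suc (suc i)) w)

0<heightAt : ∀ w i → i < length w → 0 < heightAt w i
0<heightAt (false ∷ w) zero    _         = s≤s z≤n
0<heightAt (true  ∷ w) zero    _         = s≤s z≤n
0<heightAt (b ∷ w)     (suc i) (s≤s i<) = subst (0 <_) (sym (heightAt-suc b w i)) (0<heightAt w i i<)

heightAt⇒<length : ∀ w i → 0 < heightAt w i → i < length w
heightAt⇒<length (b ∷ w) zero    _  = s≤s z≤n
heightAt⇒<length (b ∷ w) (suc i) lt = s≤s (heightAt⇒<length w i (subst (0 <_) (heightAt-suc b w i) lt))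

module Walk (W : List Bool) where

  -- That `w` is `W` from column i on, expressed through the data on which edges depend.
  record Suffix (i : ℕ) (w : List Bool) : Set where
    constructor suffix
    field
      heights : ∀ d → heightAt W (d ℕ.+ i) ≡ heightAt w d
      lengths : length w ℕ.+ i ≡ length W

  suffix-∷ : ∀ {i b w} → Suffix i (b ∷ w) → Suffix (suc i) w
  suffix-∷ {i} {b} {w} (suffix sf len) = suffix
    (λ d → trans (cong (heightAt W) (ℕ.+-suc d i)) (trans (sf (suc d)) (heightAt-suc b w d)))
    (trans (ℕ.+-suc (length w) i) len)

  low : ∀ {i b w} → Suffix i (b ∷ w) → Cell W i 0
  low {i} {b} {w} (suffix _ len) = 0<heightAt W i (subst (suc i ≤_) len (s≤s (ℕ.m≤n+m i (length w))))

  high : ∀ {i w} → Suffix i (true ∷ w) → Cell W i 1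
  high (suffix sf _) = subst (1 <_) (sym (sf 0)) ℕ.≤-refl

  bottomRow-linked : 0 < length W → ∀ i → i ≤ length W → Linked (Edge W) (bottomRow i ++ [ (0 , 1) ])
  bottomRow-linked 0< zero    _  = (0 , 0 , 0<heightAt W 0 0< , inj₁ left) ∷ [-]
  bottomRow-linked 0< (suc zero) le = (0 , 0 , 0<heightAt W 0 le , inj₂ bottom) ∷ bottomRow-linked 0< zero z≤n
  bottomRow-linked 0< (suc i@(suc _)) le =
    (i , 0 , 0<heightAt W i le , inj₂ bottom) ∷ bottomRow-linked 0< i (ℕ.<⇒≤ le)

  end-linked : ∀ i → suc i ≡ length W → Linked (Edge W) ((suc i , 1) ∷ bottomRow (suc i) ++ [ (0 , 1) ])
  end-linked i len =
    (i , 0 , 0<heightAt W i (ℕ.≤-reflexive len) , inj₂ right) ∷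
    bottomRow-linked (subst (0 <_) len (s≤s z≤n)) (suc i) (ℕ.≤-reflexive len)

  -- The path follows the line y = 1, which borders every column, and rises to height 2 only around
  -- the column of a 1. The length condition excludes the empty word, whose graph has no vertices.
  cycle-linked : ∀ i w → 0 < i ℕ.+ length w → Suffix i w → Linked (Edge W) ((i , 1) ∷ zigzag i w ++ [ (0 , 1) ])
  cycle-linked (suc i) [] _ (suffix _ len) = end-linked i len
  cycle-linked i (false ∷ w) _ sf = (i , 0 , low sf , inj₁ top) ∷ cycle-linked (suc i) w (s≤s z≤n) (suffix-∷ sf)
  cycle-linked i (true ∷ []) _ sf =
    (i , 1 , high sf , inj₁ left) ∷ (i , 1 , high sf , inj₁ top) ∷ (i , 1 , high sf , inj₂ right) ∷
    end-linked i (Suffix.lengths sf)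
  cycle-linked i (true ∷ b ∷ w) _ sf =
    (i , 1 , high sf , inj₁ left) ∷ (i , 1 , high sf , inj₁ top) ∷ (i , 1 , high sf , inj₂ right) ∷
    (suc i , 0 , low (suffix-∷ sf) , inj₁ top) ∷
    cycle-linked (suc (suc i)) w (s≤s z≤n) (suffix-∷ (suffix-∷ sf))

bottomRow⁺ : ∀ i x → x ≤ i → (x , 0) ∈ bottomRow i
bottomRow⁺ zero    zero z≤n = here refl
bottomRow⁺ (suc i) x    x≤ with ℕ.m≤n⇒m<n∨m≡n x≤
... | inj₁ (s≤s x≤i) = there (bottomRow⁺ i x x≤i)
... | inj₂ refl      = here refl

zigzag⁺-row0 : ∀ i w x → x ≤ length w ℕ.+ i → (x , 0) ∈ zigzag i w
zigzag⁺-row0 i []          x x≤ = bottomRow⁺ i x x≤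
zigzag⁺-row0 i (false ∷ w) x x≤ = there (zigzag⁺-row0 (suc i) w x (subst (x ≤_) (sym (ℕ.+-suc (length w) i)) x≤))
zigzag⁺-row0 i (true ∷ []) x x≤ = there (there (there (bottomRow⁺ (suc i) x x≤)))
zigzag⁺-row0 i (true ∷ _ ∷ w) x x≤ = there (there (there (there
  (zigzag⁺-row0 (suc (suc i)) w x (subst (x ≤_) (sym (shift₂ (length w) i)) x≤)))))

cycle⁺-row1 : ∀ i w d → d ≤ length w → (d ℕ.+ i , 1) ∈ (i , 1) ∷ zigzag i w
cycle⁺-row1 i w zero _ = here refl
cycle⁺-row1 i (false ∷ w) (suc d) (s≤s d≤) = there (subst (λ x → (x , 1) ∈ (suc i , 1) ∷ zigzag (suc i) w)
  (ℕ.+-suc d i) (cycle⁺-row1 (suc i) w d d≤))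
cycle⁺-row1 i (true ∷ []) (suc zero) _ = there (there (there (here refl)))
cycle⁺-row1 i (true ∷ []) (suc (suc d)) (s≤s ())
cycle⁺-row1 i (true ∷ _ ∷ w) (suc zero) _ = there (there (there (here refl)))
cycle⁺-row1 i (true ∷ _ ∷ w) (suc (suc d)) (s≤s (s≤s d≤)) = there (there (there (there
  (subst (λ x → (x , 1) ∈ (suc (suc i) , 1) ∷ zigzag (suc (suc i)) w) (shift₂ d i)
    (cycle⁺-row1 (suc (suc i)) w d d≤)))))

-- Here the parity of the runs enters: two ones read together are followed by a third, so the top
-- corners of the second column belong to the teeth on either side.
zigzag⁺-row2 : ∀ i w d → oddRuns fresh w ≡ true → heightAt w d ≡ 2 →
               (d ℕ.+ i , 2) ∈ zigzag i w × (suc d ℕ.+ i , 2) ∈ zigzag i w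
zigzag⁺-row2 i (false ∷ w) (suc d) ok h with zigzag⁺-row2 (suc i) w d ok h
... | p , q rewrite ℕ.+-suc d i = there p , there q
zigzag⁺-row2 i (true ∷ []) zero _ _ = here refl , there (here refl)
zigzag⁺-row2 i (true ∷ _ ∷ _) zero _ _ = here refl , there (here refl)
-- Three ones lead to the same phase as one, so `ok` also serves for the word from the third letter
-- on.
zigzag⁺-row2 i (true ∷ true ∷ true ∷ w) (suc zero) ok h =
  there (here refl) , there (there (there (there (proj₁ (zigzag⁺-row2 (suc (suc i)) (true ∷ w) 0 ok refl)))))
zigzag⁺-row2 i (true ∷ false ∷ w) (suc (suc d)) ok h with zigzag⁺-row2 (suc (suc i)) w d ok h
... | p , q rewrite shift₂ d i = there (there (there (there p))) , there (there (there (there q)))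
zigzag⁺-row2 i (true ∷ true ∷ w@(true ∷ _)) (suc (suc d)) ok h with zigzag⁺-row2 (suc (suc i)) w d ok h
... | p , q rewrite shift₂ d i = there (there (there (there p))) , there (there (there (there q)))

edge-vertex : ∀ w {u v} → Edge w u v → IsVertex w u
edge-vertex w (i , j , cell , inj₁ bottom) = i , j , cell , inj₁ refl , inj₁ refl
edge-vertex w (i , j , cell , inj₁ top)    = i , j , cell , inj₁ refl , inj₂ refl
edge-vertex w (i , j , cell , inj₁ left)   = i , j , cell , inj₁ refl , inj₁ refl
edge-vertex w (i , j , cell , inj₁ right)  = i , j , cell , inj₂ refl , inj₁ refl
edge-vertex w (i , j , cell , inj₂ bottom) = i , j , cell , inj₂ refl , inj₁ refl
edge-vertex w (i , j , cell , inj₂ top)    = i , j , cell , inj₂ refl , inj₂ refl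
edge-vertex w (i , j , cell , inj₂ left)   = i , j , cell , inj₁ refl , inj₂ refl
edge-vertex w (i , j , cell , inj₂ right)  = i , j , cell , inj₂ refl , inj₂ refl

walk-vertices : ∀ w {v} l → Linked (Edge w) (l ++ [ v ]) → All (IsVertex w) l
walk-vertices w []          _        = []
walk-vertices w (u ∷ [])    (e ∷ _)  = edge-vertex w e ∷ []
walk-vertices w (u ∷ l@(_ ∷ _)) (e ∷ es) = edge-vertex w e ∷ walk-vertices w l es

length-bottomRow : ∀ i → length (bottomRow i) ≡ suc i
length-bottomRow zero    = refl
length-bottomRow (suc i) = cong suc (length-bottomRow i)

2≤zigzag : ∀ b w i → 2 ≤ length (zigzag i (b ∷ w))
2≤zigzag false []      i = s≤s (subst (1 ≤_) (sym (length-bottomRow (suc i))) (s≤s z≤n))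
2≤zigzag false (b ∷ w) i = ℕ.m≤n⇒m≤1+n (2≤zigzag b w (suc i))
2≤zigzag true  []      i = s≤s (s≤s z≤n)
2≤zigzag true  (b ∷ w) i = s≤s (s≤s z≤n)

-- Stated for nonempty words: `oddRuns fresh []` is true, but the empty graph has no cycle.
oddRuns⇒ham : ∀ b w → oddRuns fresh (b ∷ w) ≡ true → HasHamCycle (b ∷ w)
oddRuns⇒ham b w ok = (0 , 1) , zigzag 0 W , s≤s (2≤zigzag b w 0) , cycle-unique 0 W ,
                     walk-vertices W ((0 , 1) ∷ zigzag 0 W) linked , complete , linked
  where
    W : List Bool
    W = b ∷ w
    open Walk W

    linked : Linked (Edge W) ((0 , 1) ∷ zigzag 0 W ++ [ (0 , 1) ])
    linked = cycle-linked 0 W (s≤s z≤n)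
      (suffix (λ d → cong (heightAt W) (ℕ.+-identityʳ d)) (ℕ.+-identityʳ (length W)))

    near : ∀ {i x} → x ≡ i ⊎ x ≡ suc i → i < length W → x ≤ length W
    near (inj₁ refl) lt = ℕ.<⇒≤ lt
    near (inj₂ refl) lt = lt

    row0 : ∀ {x} → x ≤ length W → (x , 0) ∈ (0 , 1) ∷ zigzag 0 W
    row0 {x} le = there (zigzag⁺-row0 0 W x (subst (x ≤_) (sym (ℕ.+-identityʳ (length W))) le))

    row1 : ∀ {x} → x ≤ length W → (x , 1) ∈ (0 , 1) ∷ zigzag 0 W
    row1 {x} le = subst (λ z → (z , 1) ∈ (0 , 1) ∷ zigzag 0 W) (ℕ.+-identityʳ x) (cycle⁺-row1 0 W x le)

    row2 : ∀ {i x} → x ≡ i ⊎ x ≡ suc i → heightAt W i ≡ 2 → (x , 2) ∈ (0 , 1) ∷ zigzag 0 W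
    row2 {i} x∈ h with zigzag⁺-row2 0 W i ok h
    ... | p , q rewrite ℕ.+-identityʳ i with x∈
    ...   | inj₁ refl = there p
    ...   | inj₂ refl = there q

    complete : ∀ p → IsVertex W p → p ∈ (0 , 1) ∷ zigzag 0 W
    complete (x , y) (i , j , cell , x∈ , y∈)
      with heightAt⇒<length W i (ℕ.≤-trans (s≤s z≤n) cell) | j | y∈ | cell
    ... | lt | 0 | inj₁ refl | _ = row0 (near x∈ lt)
    ... | lt | 0 | inj₂ refl | _ = row1 (near x∈ lt)
    ... | lt | 1 | inj₁ refl | _ = row1 (near x∈ lt)
    ... | lt | 1 | inj₂ refl | 1< = row2 x∈ (ℕ.≤-antisym (heightAt≤2 W i) 1<)
    ... | lt | suc (suc j) | _ | tooHigh = ⊥-elim (ℕ.<⇒≱ tooHigh (ℕ.≤-trans (heightAt≤2 W i) (s≤s (s≤s z≤n))))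

-- Counting words

⟦_⟧ : Bool → ℤ
⟦ true ⟧  = + 1
⟦ false ⟧ = + 0

count : (List Bool → Bool) → ℕ → ℤ
count p zero    = ⟦ p [] ⟧
count p (suc n) = count (p ∘ (false ∷_)) n ℤ.+ count (p ∘ (true ∷_)) n

count-cong : ∀ {p q} → (∀ w → p w ≡ q w) → ∀ n → count p n ≡ count q n
count-cong e zero    = cong ⟦_⟧ (e [])
count-cong e (suc n) = cong₂ ℤ._+_ (count-cong (e ∘ (false ∷_)) n) (count-cong (e ∘ (true ∷_)) n)

count-cong⁺ : ∀ p q → (∀ b w → p (b ∷ w) ≡ q (b ∷ w)) → ∀ n → count p (suc n) ≡ count q (suc n)
count-cong⁺ p q e n = cong₂ ℤ._+_ (count-cong (e false) n) (count-cong (e true) n)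

count-false : ∀ n → count (λ _ → false) n ≡ + 0
count-false zero    = refl
count-false (suc n) = cong₂ ℤ._+_ (count-false n) (count-false n)

-‿interchange : ∀ a b c d → (a ℤ.- b) ℤ.+ (c ℤ.- d) ≡ (a ℤ.+ c) ℤ.- (b ℤ.+ d)
-‿interchange a b c d = trans (ℤ+.interchange a (ℤ.- b) c (ℤ.- d)) (cong (λ e → a ℤ.+ c ℤ.+ e) (sym (ℤ.neg-distrib-+ b d)))

count-∧-not : ∀ (p q : List Bool → Bool) n → count (λ w → p w ∧ not (q w)) n ≡ count p n ℤ.- count (λ w → p w ∧ q w) n
count-∧-not p q zero with p [] | q []
... | true  | true  = refl
... | true  | false = refl
... | false | _     = refl
count-∧-not p q (suc n) = trans
  (cong₂ ℤ._+_ (count-∧-not (p ∘ (false ∷_)) (q ∘ (false ∷_)) n) (count-∧-not (p ∘ (true ∷_)) (q ∘ (true ∷_)) n))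
  (-‿interchange (count (p ∘ (false ∷_)) n) _ _ _)

countList : (List Bool → Bool) → List (List Bool) → ℤ
countList p []       = + 0
countList p (w ∷ ws) = ⟦ p w ⟧ ℤ.+ countList p ws

countList-extend : ∀ p ws → countList p (concatMap (λ w → (false ∷ w) ∷ (true ∷ w) ∷ []) ws) ≡
                   countList (p ∘ (false ∷_)) ws ℤ.+ countList (p ∘ (true ∷_)) ws
countList-extend p []       = refl
countList-extend p (w ∷ ws) = begin
  f ℤ.+ (t ℤ.+ countList p (concatMap _ ws)) ≡⟨ cong (λ c → f ℤ.+ (t ℤ.+ c)) (countList-extend p ws) ⟩
  f ℤ.+ (t ℤ.+ (fs ℤ.+ ts))                  ≡⟨ ℤ.+-assoc f t _ ⟨
  (f ℤ.+ t) ℤ.+ (fs ℤ.+ ts)                  ≡⟨ ℤ+.interchange f t fs ts ⟩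
  (f ℤ.+ fs) ℤ.+ (t ℤ.+ ts)                  ∎
  where
    open ≡.≡-Reasoning
    f t fs ts : ℤ
    f  = ⟦ p (false ∷ w) ⟧
    t  = ⟦ p (true ∷ w) ⟧
    fs = countList (p ∘ (false ∷_)) ws
    ts = countList (p ∘ (true ∷_)) ws

countList-allWords : ∀ p n → countList p (allWords n) ≡ count p n
countList-allWords p zero    = ℤ.+-identityʳ _
countList-allWords p (suc n) = trans (countList-extend p (allWords n))
  (cong₂ ℤ._+_ (countList-allWords _ n) (countList-allWords _ n))

length-filter-filter : {P Q : Pred (List Bool) 0ℓ} (P? : Decidable P) (Q? : Decidable Q) → ∀ ws →
  + length (filter P? (filter Q? ws)) ≡ countList (λ w → does (Q? w) ∧ does (P? w)) ws
length-filter-filter P? Q? [] = refl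
length-filter-filter P? Q? (w ∷ ws) with does (Q? w)
... | false = trans (length-filter-filter P? Q? ws) (sym (ℤ.+-identityˡ _))
... | true with does (P? w)
...   | false = trans (length-filter-filter P? Q? ws) (sym (ℤ.+-identityˡ _))
...   | true  = cong (λ e → + 1 ℤ.+ e) (length-filter-filter P? Q? ws)

-- Words without long runs

-- Whether w has no run of more than l ones, when at most r ones may still be
-- appended to the run preceding w.
avoids : (l r : ℕ) → List Bool → Bool
avoids l r       []          = true
avoids l r       (false ∷ w) = avoids l l w
avoids l zero    (true ∷ w)  = false
avoids l (suc r) (true ∷ w)  = avoids l r w

ones : ℕ → List Bool
ones n = replicate n true

prefix-ones-≤ : ∀ {m n w} → m ≤ n → Prefix _≡_ (ones n) w → Prefix _≡_ (ones m) w
prefix-ones-≤ z≤n      _        = []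
prefix-ones-≤ (s≤s le) (e ∷ ps) = e ∷ prefix-ones-≤ le ps

-- A forbidden run either continues the ones before `w`, and so begins `w` with r + 1 ones, or lies
-- inside `w`; the induction carries both. As r ≤ l, a long run at the start of `w` contains the
-- prefix.
avoids-sound : ∀ l r w → r ≤ l → avoids l r w ≡ true →
               ¬ Prefix _≡_ (ones (suc r)) w × ¬ HasRun (suc l) w
avoids-sound l r       []          _  _  = (λ ()) , λ { (here ()) }
avoids-sound l r       (false ∷ w) _  eq with avoids-sound l l w ℕ.≤-refl eq
... | _ , ¬run = (λ { (() ∷ _) }) , λ { (here (() ∷ _)) ; (there run) → ¬run run }
avoids-sound l (suc r) (true ∷ w)  lt eq with avoids-sound l r w (ℕ.<⇒≤ lt) eq
... | ¬pre , ¬run = (λ { (_ ∷ pre) → ¬pre pre }) ,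
                    λ { (here (_ ∷ pre)) → ¬pre (prefix-ones-≤ lt pre) ; (there run) → ¬run run }

avoids-complete : ∀ l r w → avoids l r w ≡ false → Prefix _≡_ (ones (suc r)) w ⊎ HasRun (suc l) w
avoids-complete l r       (false ∷ w) eq with avoids-complete l l w eq
... | inj₁ pre = inj₂ (there (here pre))
... | inj₂ run = inj₂ (there run)
avoids-complete l zero    (true ∷ w)  eq = inj₁ (refl ∷ [])
avoids-complete l (suc r) (true ∷ w)  eq with avoids-complete l r w eq
... | inj₁ pre = inj₁ (refl ∷ pre)
... | inj₂ run = inj₂ (there run)

noRun? : ∀ k w → Dec (¬ HasRun k w)
noRun? k w = ¬? (infix? Bool._≟_ (ones k) w)

does-noRun? : ∀ l w → does (noRun? (suc l) w) ≡ avoids l l w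
does-noRun? l w with avoids l l w in eq
... | true  = dec-true (noRun? (suc l) w) (proj₂ (avoids-sound l l w ℕ.≤-refl eq))
... | false = dec-false (noRun? (suc l) w) λ ¬run → ¬run (run (avoids-complete l l w eq))
  where
    run : Prefix _≡_ (ones (suc l)) w ⊎ HasRun (suc l) w → HasRun (suc l) w
    run (inj₁ pre) = here pre
    run (inj₂ r)   = r

-- Generating series

gf : (List Bool → Bool) → Series
gf p n zero    = count p n
gf p n (suc m) = + 0

gf-step : ∀ p → gf p ≋ C ⟦ p [] ⟧ ⊕ X ⊗ gf (p ∘ (false ∷_)) ⊕ X ⊗ gf (p ∘ (true ∷_))
gf-step p zero m = trans (const m) (sym (cong₂ (λ s t → C ⟦ p [] ⟧ 0 m ℤ.+ s ℤ.+ t)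
  (X⊗-zero (gf (p ∘ (false ∷_))) m) (X⊗-zero (gf (p ∘ (true ∷_))) m)))
  where
    const : ∀ m → gf p 0 m ≡ C ⟦ p [] ⟧ 0 m ℤ.+ + 0 ℤ.+ + 0
    const zero    = sym (trans (ℤ.+-identityʳ _) (ℤ.+-identityʳ _))
    const (suc m) = refl
gf-step p (suc n) m = trans (shift m) (sym (cong₂ (λ s t → + 0 ℤ.+ s ℤ.+ t)
  (X⊗-suc (gf (p ∘ (false ∷_))) n m) (X⊗-suc (gf (p ∘ (true ∷_))) n m)))
  where
    shift : ∀ m → gf p (suc n) m ≡ + 0 ℤ.+ gf (p ∘ (false ∷_)) n m ℤ.+ gf (p ∘ (true ∷_)) n m
    shift zero    = cong (λ e → e ℤ.+ count (p ∘ (true ∷_)) n) (sym (ℤ.+-identityˡ (count (p ∘ (false ∷_)) n)))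
    shift (suc m) = refl

X⊗gf-false : ∀ {p} → (∀ w → p w ≡ false) → X ⊗ gf p ≋ 𝕊.0#
X⊗gf-false {p} e = 𝕊.trans (𝕊.*-congˡ {X} {gf p} {𝕊.0#} gf≋0) (𝕊.zeroʳ X)
  where
    gf≋0 : gf p ≋ 𝕊.0#
    gf≋0 n zero    = trans (count-cong e n) (count-false n)
    gf≋0 n (suc m) = refl

gf-step-false : ∀ p → (∀ w → p (true ∷ w) ≡ false) → gf p ≋ C ⟦ p [] ⟧ ⊕ X ⊗ gf (p ∘ (false ∷_))
gf-step-false p e = 𝕊.trans (gf-step p)
  (𝕊.trans (𝕊.+-congˡ {C ⟦ p [] ⟧ ⊕ X ⊗ gf (p ∘ (false ∷_))} (X⊗gf-false e)) (𝕊.+-identityʳ _))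

module Id = Identities seriesRing C-homomorphism

-- Functional equations for `T` and `A`

module _ (l : ℕ) where

  T A : Series
  T = gf (avoids l l)
  A = gf (λ w → avoids l l w ∧ oddRuns fresh w)

  -- With room for r more ones, a word has up to r leading ones and then ends or continues with 0
  -- and a word of `T`: a geometric progression.
  avoiding-series : ∀ r → (C (+ 1) ⊖ X) ⊗ gf (avoids l r) ≋ (C (+ 1) ⊕ X ⊗ T) ⊗ (C (+ 1) ⊖ X ^^ suc r)
  avoiding-series zero    = Id.geometric-base X (C (+ 1) ⊕ X ⊗ T) (gf (avoids l 0))
    (gf-step-false (avoids l 0) (λ _ → refl))
  avoiding-series (suc r) = 𝕊.trans (𝕊.*-congˡ {C (+ 1) ⊖ X} (gf-step (avoids l (suc r))))
    (Id.geometric-step X (C (+ 1) ⊕ X ⊗ T) (gf (avoids l r)) (X ^^ suc r) (avoiding-series r))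

  -- Continuations of a run of odd, respectively positive even, length to which r more ones may be
  -- added.
  O E : ℕ → Series
  O r = gf (λ w → avoids l r w ∧ oddRuns odd w)
  E r = gf (λ w → avoids l r w ∧ oddRuns even⁺ w)

  E-suc : ∀ r → E (suc r) ≋ X ⊗ O r
  E-suc r = 𝕊.trans (gf-step (λ w → avoids l (suc r) w ∧ oddRuns even⁺ w))
    (𝕊.trans (𝕊.+-congʳ {X ⊗ O r} (𝕊.trans (𝕊.+-congˡ {C (+ 0)} (X⊗gf-false (λ w → ∧-zeroʳ (avoids l l w)))) C0))
             (𝕊.+-identityˡ (X ⊗ O r)))
    where
      C0 : C (+ 0) ⊕ 𝕊.0# ≋ 𝕊.0#
      C0 zero    zero    = refl
      C0 zero    (suc m) = refl
      C0 (suc n) m       = refl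

  O-zero : O 0 ≋ C (+ 1) ⊕ X ⊗ A
  O-zero = gf-step-false (λ w → avoids l 0 w ∧ oddRuns odd w) (λ _ → refl)

  -- One more 1 would make the run even with no room left to repair it.
  O-one : O 1 ≋ C (+ 1) ⊕ X ⊗ A
  O-one = gf-step-false (λ w → avoids l 1 w ∧ oddRuns odd w) E-zero
    where
      E-zero : ∀ w → avoids l 0 w ∧ oddRuns even⁺ w ≡ false
      E-zero []          = refl
      E-zero (false ∷ w) = ∧-zeroʳ (avoids l l w)
      E-zero (true ∷ w)  = refl

  -- An odd run stays odd by ending here or by growing by two ones.
  O-step : ∀ r → O (suc (suc r)) ≋ (C (+ 1) ⊕ X ⊗ A) ⊕ (X ⊗ X) ⊗ O r
  O-step r = 𝕊.trans (gf-step (λ w → avoids l (suc (suc r)) w ∧ oddRuns odd w))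
    (𝕊.+-congˡ {C (+ 1) ⊕ X ⊗ A} (𝕊.trans (𝕊.*-congˡ {X} (E-suc r)) (𝕊.sym (𝕊.*-assoc X X (O r)))))

  -- In use r = k - 2, the room left after an initial 1, and e = 2⌊k/2⌋, twice the number of odd
  -- lengths below k.
  OddSeries : ℕ → ℕ → Set
  OddSeries r e = (C (+ 1) ⊖ X ⊗ X) ⊗ O r ≋ (C (+ 1) ⊕ X ⊗ A) ⊗ (C (+ 1) ⊖ X ^^ e)

  odd-base : ∀ r → O r ≋ C (+ 1) ⊕ X ⊗ A → OddSeries r 2
  odd-base r e = 𝕊.trans (Id.geometric-base (X ⊗ X) (C (+ 1) ⊕ X ⊗ A) (O r) e)
    (𝕊.*-congˡ {C (+ 1) ⊕ X ⊗ A} (𝕊.+-congˡ {C (+ 1)} (𝕊.-‿cong (𝕊.*-assoc X X (C (+ 1))))))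

  odd-step : ∀ r e → OddSeries r e → OddSeries (suc (suc r)) (suc (suc e))
  odd-step r e h = 𝕊.trans (𝕊.*-congˡ {C (+ 1) ⊖ X ⊗ X} (O-step r))
    (𝕊.trans (Id.geometric-step (X ⊗ X) (C (+ 1) ⊕ X ⊗ A) (O r) (X ^^ e) h)
      (𝕊.*-congˡ {C (+ 1) ⊕ X ⊗ A} (𝕊.+-congˡ {C (+ 1)} (𝕊.-‿cong (𝕊.*-assoc X X (X ^^ e))))))

  odd-series : ∀ r → (r ≡ 0 ⊎ r ≡ 1) → ∀ j → OddSeries (double j ℕ.+ r) (double (suc j))
  odd-series r (inj₁ refl) zero = odd-base 0 O-zero
  odd-series r (inj₂ refl) zero = odd-base 1 O-one
  odd-series r r∈ (suc j) = odd-step (double j ℕ.+ r) (double (suc j)) (odd-series r r∈ j)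

A-step : ∀ l → A (suc l) ≋ C (+ 1) ⊕ X ⊗ A (suc l) ⊕ X ⊗ O (suc l) l
A-step l = gf-step (λ w → avoids (suc l) (suc l) w ∧ oddRuns fresh w)

-- The series `H` in terms of `T` and `A`

module _ (ham : List Bool → ℕ) (isHam : IsHamIndicator ham) where

  ham-oddRuns : ∀ b w → ham (b ∷ w) ≡ (if oddRuns fresh (b ∷ w) then 1 else 0)
  ham-oddRuns b w with oddRuns fresh (b ∷ w) in eq | isHam (b ∷ w)
  ... | true  | inj₁ (_ , h)    = h
  ... | true  | inj₂ (¬hc , _)  = ⊥-elim (¬hc (oddRuns⇒ham b w eq))
  ... | false | inj₁ (hc , _)   = ⊥-elim (¬oddRuns⇒¬ham (b ∷ w) eq hc)
  ... | false | inj₂ (_ , h)    = h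

  hamIs : ℕ → List Bool → Bool
  hamIs 0             w = not (oddRuns fresh w)
  hamIs 1             w = oddRuns fresh w
  hamIs (suc (suc _)) w = false

  does-ham : ∀ m b w → does (ham (b ∷ w) ℕ.≟ m) ≡ hamIs m (b ∷ w)
  does-ham m b w rewrite ham-oddRuns b w with oddRuns fresh (b ∷ w) in eq | m
  ... | true  | 0             rewrite eq = refl
  ... | true  | 1             rewrite eq = refl
  ... | true  | suc (suc _)   = refl
  ... | false | 0             rewrite eq = refl
  ... | false | 1             rewrite eq = refl
  ... | false | suc (suc _)   = refl

  H-count : ∀ l n m → H (suc l) ham (suc n) m ≡ count (λ w → avoids l l w ∧ hamIs m w) (suc n)
  H-count l n m = trans (length-filter-filter (λ w → ham w ℕ.≟ m) (noRun? (suc l)) (allWords (suc n)))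
    (trans (countList-allWords _ (suc n))
           (count-cong⁺ (λ w → does (noRun? (suc l) w) ∧ does (ham w ℕ.≟ m)) (λ w → avoids l l w ∧ hamIs m w)
             (λ b w → cong₂ _∧_ (does-noRun? l (b ∷ w)) (does-ham m b w)) n))

  -- The coefficient of q counts the words of `A`, the constant one the other words of `T`;
  -- subtracting 1 removes the empty word, since `H` starts at n = 1.
  H-split : ∀ l → H (suc l) ham ≋ (T l ⊖ C (+ 1)) ⊕ (Q ⊖ C (+ 1)) ⊗ (A l ⊖ C (+ 1))
  H-split l = 𝕊.trans pointwise (𝕊.sym (Id.split-Q Q (T l ⊖ C (+ 1)) (A l ⊖ C (+ 1))))
    where
      B : Series
      B = A l ⊖ C (+ 1)
      pointwise : H (suc l) ham ≋ (T l ⊖ C (+ 1)) ⊕ (Q ⊗ B ⊖ B)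
      pointwise zero zero          rewrite Q⊗-zero B 0 = refl
      pointwise zero (suc zero)    rewrite Q⊗-suc B 0 0 = refl
      pointwise zero (suc (suc m)) rewrite Q⊗-suc B 0 (suc m) = refl
      pointwise (suc n) zero rewrite Q⊗-zero B (suc n) = trans (H-count l n 0)
        (trans (count-∧-not (avoids l l) (oddRuns fresh) (suc n))
        (cong₂ ℤ._+_ (sym (ℤ.+-identityʳ (T l (suc n) 0)))
          (sym (trans (ℤ.+-identityˡ _) (cong ℤ.-_ (ℤ.+-identityʳ (A l (suc n) 0)))))))
      pointwise (suc n) (suc zero) rewrite Q⊗-suc B (suc n) 0 = trans (H-count l n 1)
        (sym (trans (ℤ.+-identityˡ _) (trans (ℤ.+-identityʳ _) (ℤ.+-identityʳ _))))
      pointwise (suc n) (suc (suc m)) rewrite Q⊗-suc B (suc n) (suc m) = trans (H-count l n (suc (suc m)))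
        (trans (count-cong (λ w → ∧-zeroʳ (avoids l l w)) (suc n)) (count-false (suc n)))

-- Floors and exponents

2*≡double : ∀ n → 2 ℕ.* n ≡ double n
2*≡double zero    = refl
2*≡double (suc n) = trans (ℕ.*-suc 2 n) (cong (suc ∘ suc) (2*≡double n))

half-double : ∀ n → double n ℕ./ 2 ≡ n
half-double zero    = refl
half-double (suc n) = trans (m/n≡1+[m∸n]/n {double (suc n)} {2} (s≤s (s≤s z≤n))) (cong suc (half-double n))

half-suc-double : ∀ n → suc (double n) ℕ./ 2 ≡ n
half-suc-double zero    = refl
half-suc-double (suc n) = trans (m/n≡1+[m∸n]/n {suc (double (suc n))} {2} (s≤s (s≤s z≤n))) (cong suc (half-suc-double n))

parity : ∀ n → ∃[ j ] (n ≡ double j ⊎ n ≡ suc (double j))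
parity zero          = 0 , inj₁ refl
parity (suc zero)    = 0 , inj₂ refl
parity (suc (suc n)) with parity n
... | j , inj₁ refl = suc j , inj₁ refl
... | j , inj₂ refl = suc j , inj₂ refl

-- The closed form

module _ (ham : List Bool → ℕ) (isHam : IsHamIndicator ham) where

  -- Here k = l + 2: runs have at most l + 1 ones, and an initial 1 leaves room for l more.
  combined : ∀ l y → OddSeries (suc l) l y →
    let d₁ = Id.D₁ X (X ^^ (suc (suc (suc l)))); d₂ = Id.D₂ X (X ^^ suc (suc y)) in
    d₁ ⊗ d₂ ⊗ H (suc (suc l)) ham ≋
    d₂ ⊗ (C (+ 1) ⊖ X ^^ suc (suc l)) ⊖ d₁ ⊗ d₂ ⊕
      (Q ⊖ C (+ 1)) ⊗ (d₁ ⊗ (C (+ 1) ⊖ X ⊗ X ⊕ X ⊗ (C (+ 1) ⊖ X ^^ y)) ⊖ d₁ ⊗ d₂)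
  combined l y hO = 𝕊.trans (𝕊.*-congˡ {d₁ ⊗ d₂} (H-split ham isHam (suc l)))
    (Id.combine d₁ d₂ Q (T (suc l)) (A (suc l)) _ _
      (Id.avoiding X (T (suc l)) (X ^^ suc (suc l)) (avoiding-series (suc l) (suc l)))
      (Id.odd-runs X (A (suc l)) (O (suc l) l) (X ^^ y) (A-step l) hO))
    where
      d₁ d₂ : Series
      d₁ = Id.D₁ X (X ^^ (suc (suc (suc l))))
      d₂ = Id.D₂ X (X ^^ suc (suc y))

-- Generalising the exponents keeps ⌊_/2⌋ out of the ring computations.
from-exponents : ∀ k h {p e y z} → k ℕ.+ 1 ≡ p → 2 ℕ.* (1 ℕ.+ k ℕ./ 2) ≡ e → 2 ℕ.* (k ℕ./ 2) ≡ y →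
  2 ℕ.* ((k ℕ.∸ 1) ℕ./ 2) ≡ z →
  Id.D₁ X (X ^^ p) ⊗ Id.D₂ X (X ^^ e) ⊗ h ≋ Id.numerator X Q (X ^^ p) (X ^^ y) (X ^^ z) →
  Den k ⊗ h ≋ Num k
from-exponents k h refl refl refl refl eq = eq

theorem4p1 : (k : ℕ) → 2 ≤ k → (ham : List Bool → ℕ) → IsHamIndicator ham →
    ∀ n m → (Den k ⊗ H k ham) n m ≡ Num k n m
theorem4p1 (suc (suc l)) (s≤s (s≤s z≤n)) ham isHam with parity l
-- For k = 2(j + 1) the two floors differ by one, and X^(2j) is the power from which the others are
-- built.
... | j , inj₁ refl = from-exponents k (H k ham)
    (ℕ.+-comm k 1)
    (trans (cong (λ i → 2 ℕ.* suc i) (half-double (suc j))) (2*≡double (suc (suc j))))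
    (trans (cong (2 ℕ.*_) (half-double (suc j))) (2*≡double (suc j)))
    (trans (cong (2 ℕ.*_) (half-suc-double j)) (2*≡double j))
    (𝕊.trans (combined ham isHam (double j) (double (suc j))
               (subst (λ r → OddSeries (suc (double j)) r (double (suc j))) (ℕ.+-identityʳ (double j))
                 (odd-series (suc (double j)) 0 (inj₁ refl) j)))
            (Id.numerator-even X Q (X ^^ double j)))
  where
    k : ℕ
    k = double (suc j)
-- For k = 2(j + 1) + 1 both floors equal j + 1.
... | j , inj₂ refl = from-exponents k (H k ham)
    (ℕ.+-comm k 1)
    (trans (cong (λ i → 2 ℕ.* suc i) (half-suc-double (suc j))) (2*≡double (suc (suc j))))
    (trans (cong (2 ℕ.*_) (half-suc-double (suc j))) (2*≡double (suc j)))
    (trans (cong (2 ℕ.*_) (half-double (suc j))) (2*≡double (suc j)))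
    (𝕊.trans (combined ham isHam (suc (double j)) (double (suc j))
               (subst (λ r → OddSeries (suc (suc (double j))) r (double (suc j))) (ℕ.+-comm (double j) 1)
                 (odd-series (suc (suc (double j))) 1 (inj₂ refl) j)))
            (Id.numerator-odd X Q (X ^^ double (suc j))))
  where
    k : ℕ
    k = suc (double (suc j))
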